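{- Let $n\geq 2$ be fixed and let $K_n'$ be the dual of the complete graph $K_n$. Run the CU-process on $K_n'$ in the $N$-uniform model (respectively, in the $N$-balanced model). Then, in each of the two models, the counter of each vertex $v$ of $K_n'$ satisfies $c_v^{(N)}/N=\frac{n}{n-1}+o(1)$ with high probability as $N\to\infty$. Hence the relative error of each edge $e$ of $K_n'$ satisfies $R_e^{(N)}=\frac{1}{n-1}+o(1)$ with high probability as $N\to\infty$. (Here "$X_N=c+o(1)$ with high probability as $N\to\infty$" means that for every $\epsilon>0$, $\mathbb{P}(|X_N-c|\leq\epsilon)\to 1$ as $N\to\infty$.)
   Context: The dual of a hypergraph $H$ is the hypergraph $H'$ in which the roles of vertices and edges are interchanged: its vertices are the edges of $H$, and its edges are indexed by the vertices of $H$, the edge corresponding to a vertex $v$ of $H$ consisting of the edges of $H$ incident to $v$. Thus $K_n'$ has $\binom n2$ vertices (the pairs $\{i,j\}\subset\{1,\dots,n\}$) and $n$ edges $e_1,\dots,e_n$, where $e_i$ is the set of all pairs containing $i$ (edges are regarded as distinct when their indices are distinct); each edge contains $n-1$ vertices and each vertex lies in exactly two edges. CU-process on a hypergraph $H=(V,E)$: each vertex $v$ carries a counter $c_v$ with initial value $0$. At each step an edge $e\in E$ is drawn, and those $c_v$, $v\in e$, with $c_v=\min_{u\in e}c_u$ (values before the step) are simultaneously incremented by $1$; the other counters do not change. $c_v(t)$ is the value of $c_v$ after $t$ steps, $o_e(t)$ is the number of times $e$ was drawn in the first $t$ steps, $c_e(t)=\min_{v\in e}c_v(t)$, and $R_e(t)=\frac{c_e(t)-o_e(t)}{o_e(t)}$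 (set to $+\infty$ if $o_e(t)=0$). Models, with $m=|E|$ (here $m=n$) and $N\geq1$ an integer: in the $N$-uniform model, the process runs for $Nm$ steps, the edge at each step being drawn independently and uniformly from $E$; in the $N$-balanced model, the sequence of $Nm$ drawn edges is a uniformly random permutation of the multiset containing $N$ copies of each edge. In both, $c_v^{(N)}=c_v(Nm)$ and $R_e^{(N)}=R_e(Nm)$. -}

module Defs where

open import Data.Bool.Base using (if_then_else_)
open import Data.Empty using (⊥)
open import Data.Fin.Base using (Fin)
open import Data.Fin.Properties using (all?; _≟_; _<?_)
open import Data.Fin.Subset using (Subset; ⁅_⁆; _∪_)
open import Data.Fin.Subset.Properties using (_∈?_)
import Data.Integer.Base as ℤ
open import Data.List.Base
  using (List; []; _∷_; length; map; filter; foldl; lookup; allFin; cartesianProduct; cartesianProductWith)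
open import Data.List.Extrema.Nat using (min)
open import Data.Nat.Base as ℕ using (ℕ; zero; suc; NonZero)
import Data.Nat.Properties as ℕ
open import Data.Product.Base using (∃; _×_; _,_; uncurry)
open import Data.Rational using (ℚ; 0ℚ; 1ℚ; _/_; _-_; ∣_∣; _≤_; _<_; _≤?_)
import Data.Vec.Base as Vec
open import Relation.Nullary.Construct.Add.Supremum using (_⁺; ⊤⁺; [_])
open import Relation.Nullary.Decidable using (no; does; _×-dec_)
open import Relation.Unary using (Decidable)

-- Finite hypergraphs. Edges are indexed, so distinct indices give distinct
-- edges even when the underlying vertex sets coincide.
record Hypergraph : Set where
  field
    #V #E : ℕ
    edge  : Fin #E → Subset #V

open Hypergraph public

dual : Hypergraph → Hypergraph
dual H .#V     = #E H
dual H .#E     = #V H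
dual H .edge v = Vec.tabulate λ e → does (v ∈? edge H e)

pairs : (n : ℕ) → List (Fin n × Fin n)
pairs n = filter (uncurry _<?_) (cartesianProduct (allFin n) (allFin n))

K : ℕ → Hypergraph
K n .#V     = n
K n .#E     = length (pairs n)
K n .edge k = let (i , j) = lookup (pairs n) k in ⁅ i ⁆ ∪ ⁅ j ⁆

-- The value 0 at [] only concerns hypergraphs with an empty edge.
minimum : List ℕ → ℕ
minimum []       = 0
minimum (x ∷ xs) = min x xs

module CU (H : Hypergraph) where

  Counters : Set
  Counters = Fin (#V H) → ℕ

  edgeCounter : Counters → Fin (#E H) → ℕ
  edgeCounter c e = minimum (map c (filter (_∈? edge H e) (allFin (#V H))))

  step : Counters → Fin (#E H) → Counters
  step c e v =
    if does ((v ∈? edge H e) ×-dec (c v ℕ.≟ edgeCounter c e))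
    then suc (c v) else c v

  -- State after all the draws of a sequence, whose head is the first draw.
  counters : List (Fin (#E H)) → Counters
  counters = foldl step (λ _ → 0)

occurrences : ∀ {m} → Fin m → List (Fin m) → ℕ
occurrences e s = length (filter (e ≟_) s)

-- ⊤⁺ plays the role of +∞.
relErr : (c o : ℕ) → ℚ ⁺
relErr c zero      = ⊤⁺
relErr c o@(suc _) = [ (ℤ.+ c ℤ.- ℤ.+ o) / o ]

vertexRatio : (H : Hypergraph) → Fin (#V H) → (N : ℕ) → .{{NonZero N}} → List (Fin (#E H)) → ℚ ⁺
vertexRatio H v N s = [ ℤ.+ CU.counters H s v / N ]

edgeError : (H : Hypergraph) → Fin (#E H) → List (Fin (#E H)) → ℚ ⁺
edgeError H e s = relErr (CU.edgeCounter H (CU.counters H s) e) (occurrences e s)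

sequences : (m k : ℕ) → List (List (Fin m))
sequences m zero    = [] ∷ []
sequences m (suc k) = cartesianProductWith _∷_ (allFin m) (sequences m k)

data Model : Set where
  uniform balanced : Model

-- The equally likely draw sequences of the N-uniform and N-balanced models
-- on m edges. Each arrangement of the multiset is listed once in the balanced
-- case; it arises from the same number, (N !) ^ m, of permutations of Nm
-- labelled copies.
outcomes : Model → (m N : ℕ) → List (List (Fin m))
outcomes uniform  m N = sequences m (N ℕ.* m)
outcomes balanced m N =
  filter (λ s → all? λ e → occurrences e s ℕ.≟ N) (sequences m (N ℕ.* m))

-- Probability of an event under the uniform distribution on a list of
-- outcomes; the value on the empty list is a dummy.
Pr : ∀ {A : Set} {P : A → Set} → List A → Decidable P → ℚ
Pr []         P? = 0ℚ
Pr Ω@(_ ∷ _) P? = ℤ.+ length (filter P? Ω) / length Ω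

-- ∣ x - c ∣ ≤ ε, which fails for x = +∞.
Within : ℚ → ℚ → ℚ ⁺ → Set
Within ε c ⊤⁺    = ⊥
Within ε c [ x ] = ∣ x - c ∣ ≤ ε

within? : ∀ ε c → Decidable (Within ε c)
within? ε c ⊤⁺    = no λ ()
within? ε c [ x ] = ∣ x - c ∣ ≤? ε

_⟶_ : ((N : ℕ) → .{{NonZero N}} → ℚ) → ℚ → Set
f ⟶ l = ∀ δ → 0ℚ < δ →
  ∃ λ N₀ → ∀ N → .{{_ : NonZero N}} → N₀ ℕ.≤ N → ∣ f N - l ∣ < δ

-- "X N = c + o(1) with high probability as N → ∞", where X N is a random
-- variable on the uniform probability space Ω N.
WHP : ∀ {A : Set} → (Ω : ℕ → List A) → (X : (N : ℕ) → .{{NonZero N}} → A → ℚ ⁺) → ℚ → Set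
WHP Ω X c = ∀ ε → 0ℚ < ε →
  (λ N → Pr (Ω N) (λ ω → within? ε c (X N ω))) ⟶ 1ℚ

{-# OPTIONS --safe #-}
-- Write h for a level function on the indices 1, …, n, initially 0, and identify a vertex of K_n'
-- with a pair {i , j}. The counter of {i , j} is always h i ⊔ h j, where the minimum of h is
-- attained at least twice: drawing i raises h i by one, and if this leaves a single index b at the
-- minimum, then raising h b by one too changes no counter. So the counter of the edge e_i is h i,
-- and since at each level exactly one of the n indices passes for free, after t draws
-- ∑ h ≡ t + min h, hence (n ∸ 1) * min h ≤ t. An index above the minimum rises only when drawn, at
-- rate 1/n < 1/(n ∸ 1), so once all suffixes of the draw sequence are nearly equidistributed no
-- level can exceed t/(n ∸ 1) by much; by the formula for ∑ h none can then be much below it either.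
--
-- Equidistribution of the suffixes follows from Chebyshev's inequality at a bounded number of
-- checkpoints. Both models are exchangeable with draws that are not positively correlated, so the
-- second moment of a suffix count is at most linear in its length.
module Submission where

open import Defs
open import Algebra.Properties.AbelianGroup using (⁻¹-anti-homo‿-)
open import Data.Bool.Base using (true; false; if_then_else_)
open import Data.Fin.Base using (Fin)
import Data.Fin.Base as Fin
import Data.Fin.Properties as Fin
import Data.Fin.Subset as Subset
open import Data.Fin.Subset.Properties using (_∈?_; x∈⁅x⁆; x∈⁅y⁆⇒x≡y; x∈p∪q⁺; x∈p∪q⁻)
open import Data.Integer.Base as ℤ
  using (ℤ; +_; +0; +[1+_]; -[1+_]; 0ℤ; 1ℤ; -_; _+_; _-_; _*_; +≤+; +<+;
         Positive; NonNegative; positive; nonNegative)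
open import Data.Integer.Properties
open import Data.Integer.Tactic.RingSolver using (solve-∀)
open import Data.List.Base as List
  using (List; []; _∷_; _++_; _∷ʳ_; length; filter; allFin; upTo; drop; foldl; lookup;
         cartesianProductWith)
open import Data.List.Extrema.Nat using (min≤v⁺; v≤min⁺)
open import Data.List.Membership.Propositional using (_∈_)
open import Data.List.Membership.Propositional.Properties
import Data.List.Properties as List
import Data.List.Relation.Unary.All as All
import Data.List.Relation.Unary.Any as Any
open import Data.List.Relation.Unary.Any using (here; there)
import Data.List.Relation.Unary.Any.Properties as Any
open import Data.Nat.Base as ℕ using (ℕ; zero; suc; _≤_; _∸_; >-nonZero)
open import Data.Nat.DivMod using (m/n*n≤m; m≡m%n+[m/n]*n; m%n<n; /-monoˡ-≤; m*n/n≡m; 0/n≡0)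
import Data.Nat.Properties as ℕ
open import Data.Nat.Properties using (m<n⇒0<n∸m)
open import Data.Product.Base using (_×_; _,_; proj₁; proj₂; ∃; ∃₂; uncurry)
open import Data.Rational as ℚ using (ℚ; 0ℚ; 1ℚ; mkℚ; _/_; toℚᵘ)
import Data.Rational.Properties as ℚ
import Data.Rational.Unnormalised as ℚᵘ
import Data.Rational.Unnormalised.Properties as ℚᵘ
open import Data.Sum.Base using (_⊎_; inj₁; inj₂)
import Data.Vec.Properties as Vec
open import Function.Base using (_∘_; id; case_of_)
open import Relation.Binary.Definitions using (tri<; tri≈; tri>)
open import Relation.Binary.PropositionalEquality
open import Relation.Nullary.Construct.Add.Supremum using (_⁺; [_])
open import Relation.Nullary.Decidable using (Dec; does; yes; no; dec-true; dec-false; _×-dec_; ¬?)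
open import Relation.Nullary.Negation using (¬_; contradiction)
open import Relation.Unary using (Decidable)

private variable
  A B : Set

-- Integer sums over lists

≤-from-difference : ∀ {i j k} → 0ℤ ℤ.≤ k → k ≡ j - i → i ℤ.≤ j
≤-from-difference 0≤k k≡j-i = 0≤i-j⇒j≤i (subst (0ℤ ℤ.≤_) k≡j-i 0≤k)

0≤+ : ∀ n → 0ℤ ℤ.≤ + n
0≤+ n = +≤+ ℕ.z≤n

0≤i+j : ∀ {i j} → 0ℤ ℤ.≤ i → 0ℤ ℤ.≤ j → 0ℤ ℤ.≤ i + j
0≤i+j = +-mono-≤

0≤i*j : ∀ {i j} → 0ℤ ℤ.≤ i → 0ℤ ℤ.≤ j → 0ℤ ℤ.≤ i * j
0≤i*j {+ m} {+ n} _ _ = subst (0ℤ ℤ.≤_) (pos-* m n) (0≤+ _)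

0≤i*i : ∀ i → 0ℤ ℤ.≤ i * i
0≤i*i (+ n)    = 0≤i*j {+ n} (0≤+ n) (0≤+ n)
0≤i*i -[1+ n ] = +≤+ ℕ.z≤n

i*i≤j*j⇒i≤j : ∀ {i j} → 0ℤ ℤ.≤ j → i * i ℤ.≤ j * j → i ℤ.≤ j
i*i≤j*j⇒i≤j {i} {j} 0≤j ii≤jj with i ≤? j
... | yes i≤j = i≤j
... | no  i≰j = contradiction ii≤jj (<⇒≱ (≤-<-trans (*-monoʳ-≤-nonNeg j (<⇒≤ j<i)) (*-monoˡ-<-pos i j<i)))
  where
  j<i = ≰⇒> i≰j
  instance
    i>0 : Positive i
    i>0 = positive (≤-<-trans 0≤j j<i)
    j≥0 : NonNegative j
    j≥0 = nonNegative 0≤j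

𝟙 : ∀ {P : Set} → Dec P → ℤ
𝟙 P? = if does P? then 1ℤ else 0ℤ

𝟙-⇔ : ∀ {P Q : Set} (P? : Dec P) (Q? : Dec Q) → (P → Q) → (Q → P) → 𝟙 P? ≡ 𝟙 Q?
𝟙-⇔ (yes p) (yes q) _ _ = refl
𝟙-⇔ (yes p) (no ¬q) f _ = contradiction (f p) ¬q
𝟙-⇔ (no ¬p) (yes q) _ g = contradiction (g q) ¬p
𝟙-⇔ (no ¬p) (no ¬q) _ _ = refl

∑ : (A → ℤ) → List A → ℤ
∑ f []       = 0ℤ
∑ f (x ∷ xs) = f x + ∑ f xs

∑-cong-∈ : ∀ {f g : A → ℤ} xs → (∀ {x} → x ∈ xs → f x ≡ g x) → ∑ f xs ≡ ∑ g xs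
∑-cong-∈ []       eq = refl
∑-cong-∈ (x ∷ xs) eq = cong₂ _+_ (eq (here refl)) (∑-cong-∈ xs (eq ∘ there))

∑-cong : ∀ {f g : A → ℤ} xs → (∀ x → f x ≡ g x) → ∑ f xs ≡ ∑ g xs
∑-cong xs eq = ∑-cong-∈ xs λ {x} _ → eq x

∑-mono-∈ : ∀ {f g : A → ℤ} xs → (∀ {x} → x ∈ xs → f x ℤ.≤ g x) → ∑ f xs ℤ.≤ ∑ g xs
∑-mono-∈ []       le = ≤-refl
∑-mono-∈ (x ∷ xs) le = +-mono-≤ (le (here refl)) (∑-mono-∈ xs (le ∘ there))

∑-distrib-+ : ∀ (f g : A → ℤ) xs → ∑ (λ x → f x + g x) xs ≡ ∑ f xs + ∑ g xs
∑-distrib-+ f g []       = refl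
∑-distrib-+ f g (x ∷ xs) = trans (cong (_+_ (f x + g x)) (∑-distrib-+ f g xs)) (interchange (f x) (g x) _ _)
  where
  interchange : ∀ a b c d → a + b + (c + d) ≡ a + c + (b + d)
  interchange = solve-∀

∑-distribˡ-* : ∀ a (f : A → ℤ) xs → ∑ (λ x → a * f x) xs ≡ a * ∑ f xs
∑-distribˡ-* a f []       = sym (*-zeroʳ a)
∑-distribˡ-* a f (x ∷ xs) = trans (cong (_+_ (a * f x)) (∑-distribˡ-* a f xs)) (sym (*-distribˡ-+ a (f x) _))

∑-const : ∀ a (xs : List A) → ∑ (λ _ → a) xs ≡ + length xs * a
∑-const a []       = sym (*-zeroˡ a)
∑-const a (x ∷ xs) = trans (cong (_+_ a) (∑-const a xs)) (sym (suc-* (+ length xs) a))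

∑-zero : ∀ (xs : List A) → ∑ (λ _ → 0ℤ) xs ≡ 0ℤ
∑-zero xs = trans (∑-const 0ℤ xs) (*-zeroʳ (+ length xs))

∑-comm : ∀ (f : A → B → ℤ) xs ys →
         ∑ (λ x → ∑ (f x) ys) xs ≡ ∑ (λ y → ∑ (λ x → f x y) xs) ys
∑-comm f []       ys = sym (∑-zero ys)
∑-comm f (x ∷ xs) ys = trans (cong (_+_ (∑ (f x) ys)) (∑-comm f xs ys))
                             (sym (∑-distrib-+ (f x) _ ys))

∑-++ : ∀ (f : A → ℤ) xs ys → ∑ f (xs ++ ys) ≡ ∑ f xs + ∑ f ys
∑-++ f []       ys = sym (+-identityˡ _)
∑-++ f (x ∷ xs) ys = trans (cong (_+_ (f x)) (∑-++ f xs ys)) (sym (+-assoc (f x) _ _))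

∑-map : ∀ (f : B → ℤ) (g : A → B) xs → ∑ f (List.map g xs) ≡ ∑ (f ∘ g) xs
∑-map f g []       = refl
∑-map f g (x ∷ xs) = cong (_+_ (f (g x))) (∑-map f g xs)

∑-cartesianProductWith : ∀ {C : Set} (f : C → ℤ) (g : A → B → C) xs ys →
  ∑ f (cartesianProductWith g xs ys) ≡ ∑ (λ x → ∑ (λ y → f (g x y)) ys) xs
∑-cartesianProductWith f g []       ys = refl
∑-cartesianProductWith f g (x ∷ xs) ys =
  trans (∑-++ f (List.map (g x) ys) _)
        (cong₂ _+_ (∑-map f (g x) ys) (∑-cartesianProductWith f g xs ys))

∑-filter : ∀ {P : A → Set} (P? : Decidable P) (f : A → ℤ) xs →
           ∑ f (filter P? xs) ≡ ∑ (λ x → 𝟙 (P? x) * f x) xs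
∑-filter P? f []       = refl
∑-filter P? f (x ∷ xs) with does (P? x)
... | true  = cong₂ _+_ (sym (*-identityˡ (f x))) (∑-filter P? f xs)
... | false = trans (∑-filter P? f xs)
  (sym (trans (cong (_+ ∑ (λ y → 𝟙 (P? y) * f y) xs) (*-zeroˡ (f x))) (+-identityˡ _)))

length-as-∑ : (xs : List A) → + length xs ≡ ∑ (λ _ → 1ℤ) xs
length-as-∑ xs = sym (trans (∑-const 1ℤ xs) (*-identityʳ _))

length-filter-as-∑ : ∀ {P : A → Set} (P? : Decidable P) xs →
                     + length (filter P? xs) ≡ ∑ (𝟙 ∘ P?) xs
length-filter-as-∑ P? xs =
  trans (length-as-∑ (filter P? xs))
        (trans (∑-filter P? (λ _ → 1ℤ) xs) (∑-cong xs λ x → *-identityʳ (𝟙 (P? x))))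

∑-nonneg : ∀ {f : A → ℤ} xs → (∀ x → 0ℤ ℤ.≤ f x) → 0ℤ ℤ.≤ ∑ f xs
∑-nonneg xs 0≤f = ≤-trans (≤-reflexive (sym (∑-zero xs))) (∑-mono-∈ xs λ {x} _ → 0≤f x)

term≤∑ : ∀ {f : A → ℤ} {x} xs → (∀ x → 0ℤ ℤ.≤ f x) → x ∈ xs → f x ℤ.≤ ∑ f xs
term≤∑ {f = f} (x ∷ xs) 0≤f (here refl) =
  ≤-trans (≤-reflexive (sym (+-identityʳ (f x)))) (+-monoʳ-≤ (f x) (∑-nonneg xs 0≤f))
term≤∑ {f = f} {y} (x ∷ xs) 0≤f (there y∈xs) =
  ≤-trans (≤-reflexive (sym (+-identityˡ (f y)))) (+-mono-≤ (0≤f x) (term≤∑ xs 0≤f y∈xs))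

∑-allFin-suc : ∀ n (f : Fin (suc n) → ℤ) →
               ∑ f (allFin (suc n)) ≡ f Fin.zero + ∑ (f ∘ Fin.suc) (allFin n)
∑-allFin-suc n f = cong (_+_ (f Fin.zero))
  (trans (cong (∑ f) (sym (List.map-tabulate id Fin.suc))) (∑-map f Fin.suc (allFin n)))

∑-≟ : ∀ n (i : Fin n) → ∑ (λ j → 𝟙 (i Fin.≟ j)) (allFin n) ≡ 1ℤ
∑-≟ (suc n) Fin.zero    = trans (∑-allFin-suc n (λ j → 𝟙 (Fin.zero {n} Fin.≟ j)))
  (cong (_+_ 1ℤ) (∑-zero (allFin n)))
∑-≟ (suc n) (Fin.suc i) = trans (∑-allFin-suc n (λ j → 𝟙 (Fin.suc i Fin.≟ j))) (trans (+-identityˡ _)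
  (trans (∑-cong (allFin n) λ j →
            𝟙-⇔ (Fin.suc i Fin.≟ Fin.suc j) (i Fin.≟ j) Fin.suc-injective (cong Fin.suc))
         (∑-≟ n i)))

-- Second moments under exchangeability

-- Transposition of the adjacent positions `p` and `p + 1`, the identity when these do not both
-- exist. Such transpositions generate all permutations of positions, so invariance under them is
-- exchangeability.
swap : ℕ → List A → List A
swap zero    (x ∷ y ∷ zs) = y ∷ x ∷ zs
swap zero    xs           = xs
swap (suc p) []           = []
swap (suc p) (x ∷ xs)     = x ∷ swap p xs

∑-sequences-suc : ∀ {m} k (f : List (Fin m) → ℤ) →
  ∑ f (sequences m (suc k)) ≡ ∑ (λ x → ∑ (λ xs → f (x ∷ xs)) (sequences m k)) (allFin m)
∑-sequences-suc {m} k f = ∑-cartesianProductWith f _∷_ (allFin m) (sequences m k)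

-- At position 0 this exchanges the two outermost sums; deeper positions follow by induction under
-- the first letter.
∑-sequences-swap : ∀ {m} p k (f : List (Fin m) → ℤ) →
                   ∑ f (sequences m k) ≡ ∑ (f ∘ swap p) (sequences m k)
∑-sequences-swap zero    zero          f = refl
∑-sequences-swap {m} zero (suc zero)   f =
  trans (∑-sequences-suc 0 f) (sym (∑-sequences-suc 0 (f ∘ swap 0)))
∑-sequences-swap {m} zero (suc (suc k)) f =
  trans (expand f) (trans (∑-comm _ (allFin m) (allFin m)) (sym (expand (f ∘ swap 0))))
  where
  expand : ∀ g → ∑ g (sequences m (suc (suc k))) ≡
    ∑ (λ x → ∑ (λ y → ∑ (λ zs → g (x ∷ y ∷ zs)) (sequences m k)) (allFin m)) (allFin m)
  expand g = trans (∑-sequences-suc (suc k) g)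
                   (∑-cong (allFin m) λ x → ∑-sequences-suc k (λ xs → g (x ∷ xs)))
∑-sequences-swap     (suc p) zero    f = refl
∑-sequences-swap {m} (suc p) (suc k) f =
  trans (∑-sequences-suc k f)
        (trans (∑-cong (allFin m) λ x → ∑-sequences-swap p k (λ xs → f (x ∷ xs)))
               (sym (∑-sequences-suc k (f ∘ swap (suc p)))))

sequences-length : ∀ {m} k {s} → s ∈ sequences m k → length s ≡ k
sequences-length zero    (here refl) = refl
sequences-length {m} (suc k) s∈
  with _ , _ , _ , xs∈ , refl ← ∈-cartesianProductWith⁻ _∷_ (allFin m) (sequences m k) s∈
  = cong suc (sequences-length k xs∈)

∈-sequences : ∀ {m} (s : List (Fin m)) → s ∈ sequences m (length s)
∈-sequences []       = here refl
∈-sequences (x ∷ xs) = ∈-cartesianProductWith⁺ _∷_ (∈-allFin x) (∈-sequences xs)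

∑-of-swap : ∀ (f : A → ℤ) p s → ∑ f (swap p s) ≡ ∑ f s
∑-of-swap f zero    []           = refl
∑-of-swap f zero    (x ∷ [])     = refl
∑-of-swap f zero    (x ∷ y ∷ zs) = lemma (f y) (f x) (∑ f zs)
  where
  lemma : ∀ a b c → a + (b + c) ≡ b + (a + c)
  lemma = solve-∀
∑-of-swap f (suc p) []           = refl
∑-of-swap f (suc p) (x ∷ xs)     = cong (_+_ (f x)) (∑-of-swap f p xs)

occurrences-swap : ∀ {m} (e : Fin m) p s → occurrences e (swap p s) ≡ occurrences e s
occurrences-swap e p s = +-injective
  (trans (length-filter-as-∑ (e Fin.≟_) (swap p s))
  (trans (∑-of-swap (λ x → 𝟙 (e Fin.≟ x)) p s) (sym (length-filter-as-∑ (e Fin.≟_) s))))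

-- The common interface to both models. Invariance is asked of sums of arbitrary `f`, so that no
-- bijection of the list `Ω` has to be exhibited.
record Exchangeable (T : ℕ) (Ω : List (List A)) : Set where
  field
    length-∈ : ∀ {s} → s ∈ Ω → length s ≡ T
    ∑-swap   : ∀ p (f : List A → ℤ) → ∑ f Ω ≡ ∑ (f ∘ swap p) Ω

balanced? : ∀ {m} N → Decidable (λ (s : List (Fin m)) → ∀ e → occurrences e s ≡ N)
balanced? N s = Fin.all? λ e → occurrences e s ℕ.≟ N

-- In the balanced case the selecting condition depends only on the occurrence counts, which
-- transpositions preserve, so it passes through the invariance of all sequences.
outcomes-exchangeable : ∀ M m N → Exchangeable (N ℕ.* m) (outcomes M m N)
outcomes-exchangeable uniform m N = record
  { length-∈ = sequences-length (N ℕ.* m)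
  ; ∑-swap   = λ p → ∑-sequences-swap p (N ℕ.* m)
  }
outcomes-exchangeable balanced m N = record
  { length-∈ = λ s∈ → sequences-length T (proj₁ (∈-filter⁻ (balanced? N) {xs = sequences m T} s∈))
  ; ∑-swap   = λ p f → trans (∑-filter (balanced? N) f (sequences m T))
      (trans (∑-sequences-swap p T (λ s → 𝟙 (balanced? N s) * f s))
      (trans (∑-cong (sequences m T) λ s → cong (_* f (swap p s))
               (𝟙-⇔ (balanced? N (swap p s)) (balanced? N s)
                    (λ b e → trans (sym (occurrences-swap e p s)) (b e))
                    (λ b e → trans (occurrences-swap e p s) (b e))))
             (sym (∑-filter (balanced? N) (f ∘ swap p) (sequences m T)))))
  }
  where T = N ℕ.* m

-- The value 0 past the end makes `suffixSum-step` valid at every position.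
valueAt : (A → ℤ) → ℕ → List A → ℤ
valueAt d _       []       = 0ℤ
valueAt d zero    (x ∷ xs) = d x
valueAt d (suc a) (x ∷ xs) = valueAt d a xs

suffixSum : (A → ℤ) → ℕ → List A → ℤ
suffixSum d a s = ∑ d (drop a s)

suffixSum-step : ∀ (d : A → ℤ) a s → suffixSum d a s ≡ valueAt d a s + suffixSum d (suc a) s
suffixSum-step d zero    []       = refl
suffixSum-step d (suc a) []       = refl
suffixSum-step d zero    (x ∷ xs) = refl
suffixSum-step d (suc a) (x ∷ xs) = suffixSum-step d a xs

suffixSum-length : ∀ (d : A → ℤ) s → suffixSum d (length s) s ≡ 0ℤ
suffixSum-length d []       = refl
suffixSum-length d (x ∷ xs) = suffixSum-length d xs

valueAt-swap-suc : ∀ (d : A → ℤ) p s → suc p ℕ.< length s →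
                   valueAt d (suc p) (swap p s) ≡ valueAt d p s
valueAt-swap-suc d zero    (x ∷ y ∷ s) _ = refl
valueAt-swap-suc d zero    (x ∷ [])    (ℕ.s≤s ())
valueAt-swap-suc d (suc p) (x ∷ s)     (ℕ.s≤s p<) = valueAt-swap-suc d p s p<

valueAt-swap-> : ∀ (d : A → ℤ) p b s → suc p ℕ.< b → valueAt d b (swap p s) ≡ valueAt d b s
valueAt-swap-> d zero    b             []           _ = refl
valueAt-swap-> d zero    b             (x ∷ [])     _ = refl
valueAt-swap-> d zero    (suc (suc b)) (x ∷ y ∷ s)  _ = refl
valueAt-swap-> d zero    (suc zero)    (x ∷ y ∷ s)  (ℕ.s≤s ())
valueAt-swap-> d (suc p) b             []           _ = refl
valueAt-swap-> d (suc p) (suc b)       (x ∷ s)      (ℕ.s≤s p<b) = valueAt-swap-> d p b s p<b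

valueAt-swap-0 : ∀ (d : A → ℤ) p s → valueAt d 0 (swap (suc p) s) ≡ valueAt d 0 s
valueAt-swap-0 d p []      = refl
valueAt-swap-0 d p (x ∷ s) = refl

valueAt²≤ : ∀ (d : A → ℤ) {v} → 0ℤ ℤ.≤ v → (∀ x → d x * d x ℤ.≤ v) →
            ∀ a s → valueAt d a s * valueAt d a s ℤ.≤ v
valueAt²≤ d 0≤v d²≤v _       []      = 0≤v
valueAt²≤ d 0≤v d²≤v zero    (x ∷ s) = d²≤v x
valueAt²≤ d 0≤v d²≤v (suc a) (x ∷ s) = valueAt²≤ d 0≤v d²≤v a s

module Moments {T : ℕ} {Ω : List (List A)} (Ω-exch : Exchangeable T Ω) (d : A → ℤ) where
  open Exchangeable Ω-exch

  -- A total over `Ω`, not divided by `length Ω`. No means are subtracted: the deviations to which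
  -- it is applied are already centred.
  covariance : ℕ → ℕ → ℤ
  covariance a b = ∑ (λ s → valueAt d a s * valueAt d b s) Ω

  -- Adjacent transpositions carry `a` down to 0 without touching position `b`, and then carry `b`
  -- down to 1.
  covariance-const : ∀ a b → a ℕ.< b → b ℕ.< T → covariance a b ≡ covariance 0 1
  covariance-const zero    (suc zero)    _ _ = refl
  covariance-const zero    (suc (suc b)) _ b<T =
    trans (∑-swap (suc b) _)
    (trans (∑-cong-∈ Ω λ {s} s∈ → cong₂ _*_ (valueAt-swap-0 d b s)
             (valueAt-swap-suc d (suc b) s (subst (suc (suc b) ℕ.<_) (sym (length-∈ s∈)) b<T)))
           (covariance-const zero (suc b) ℕ.z<s (ℕ.<-trans (ℕ.n<1+n _) b<T)))
  covariance-const (suc a) b a<b b<T =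
    trans (∑-swap a _)
    (trans (∑-cong-∈ Ω λ {s} s∈ → cong₂ _*_
             (valueAt-swap-suc d a s (subst (suc a ℕ.<_) (sym (length-∈ s∈)) (ℕ.<-trans a<b b<T)))
             (valueAt-swap-> d a b s a<b))
           (covariance-const a b (ℕ.<-trans (ℕ.n<1+n a) a<b) b<T))

  -- The suffix from `b` has `r` entries, and by exchangeability each of them contributes the same
  -- covariance.
  ∑-value*suffixSum : ∀ r a b → a ℕ.< b → b ℕ.+ r ≡ T →
    ∑ (λ s → valueAt d a s * suffixSum d b s) Ω ≡ + r * covariance 0 1
  ∑-value*suffixSum zero a b a<b b+0≡T =
    trans (∑-cong-∈ Ω λ {s} s∈ → trans (cong (valueAt d a s *_) (vanish s s∈)) (*-zeroʳ (valueAt d a s)))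
          (trans (∑-zero Ω) (sym (*-zeroˡ (covariance 0 1))))
    where
    vanish : ∀ s → s ∈ Ω → suffixSum d b s ≡ 0ℤ
    vanish s s∈ = subst (λ k → suffixSum d k s ≡ 0ℤ)
      (trans (length-∈ s∈) (trans (sym b+0≡T) (ℕ.+-identityʳ b))) (suffixSum-length d s)
  ∑-value*suffixSum (suc r) a b a<b b+r≡T =
    trans (∑-cong Ω λ s → trans (cong (valueAt d a s *_) (suffixSum-step d b s))
                                (*-distribˡ-+ (valueAt d a s) _ _))
    (trans (∑-distrib-+ _ _ Ω)
    (trans (cong₂ _+_
             (covariance-const a b a<b (subst (b ℕ.<_) b+r≡T (ℕ.m<m+n b ℕ.z<s)))
             (∑-value*suffixSum r a (suc b) (ℕ.m<n⇒m<1+n a<b) (trans (sym (ℕ.+-suc b r)) b+r≡T)))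
           (sym (suc-* (+ r) (covariance 0 1)))))

  second-moment-step : ∀ r s → suc s ℕ.+ r ≡ T →
    ∑ (λ ω → suffixSum d s ω * suffixSum d s ω) Ω ≡
    ∑ (λ ω → valueAt d s ω * valueAt d s ω) Ω + + 2 * (+ r * covariance 0 1)
      + ∑ (λ ω → suffixSum d (suc s) ω * suffixSum d (suc s) ω) Ω
  second-moment-step r s eq =
    trans (∑-cong Ω λ ω → trans (cong (λ z → z * z) (suffixSum-step d s ω)) (square (valueAt d s ω) _))
    (trans (∑-distrib-+ _ _ Ω) (cong (_+ ∑ (λ ω → suffixSum d (suc s) ω * suffixSum d (suc s) ω) Ω)
      (trans (∑-distrib-+ _ _ Ω) (cong (_+_ (∑ (λ ω → valueAt d s ω * valueAt d s ω) Ω))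
        (trans (∑-distribˡ-* (+ 2) _ Ω)
               (cong (+ 2 *_) (∑-value*suffixSum r s (suc s) (ℕ.n<1+n s) eq)))))))
    where
    square : ∀ x y → (x + y) * (x + y) ≡ x * x + + 2 * (x * y) + y * y
    square = solve-∀

  -- Peeling off the first entry of the suffix splits its square into a diagonal term, at most `v`
  -- per outcome, cross terms that are at most 0 in total, and the square of the shorter suffix. The
  -- bound is therefore linear in the length `r`.
  second-moment : ∀ {v} → 0ℤ ℤ.≤ v → (∀ x → d x * d x ℤ.≤ v) → covariance 0 1 ℤ.≤ 0ℤ →
    ∀ r s → s ℕ.+ r ≡ T → ∑ (λ ω → suffixSum d s ω * suffixSum d s ω) Ω ℤ.≤ + r * (+ length Ω * v)
  second-moment {v} 0≤v d²≤v cov≤0 zero s s+0≡T =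
    ≤-reflexive (trans (∑-cong-∈ Ω λ {ω} ω∈ → cong (λ z → z * z) (vanish ω ω∈))
                       (trans (∑-zero Ω) (sym (*-zeroˡ (+ length Ω * v)))))
    where
    vanish : ∀ ω → ω ∈ Ω → suffixSum d s ω ≡ 0ℤ
    vanish ω ω∈ = subst (λ k → suffixSum d k ω ≡ 0ℤ)
      (trans (length-∈ ω∈) (trans (sym s+0≡T) (ℕ.+-identityʳ s))) (suffixSum-length d ω)
  second-moment {v} 0≤v d²≤v cov≤0 (suc r) s s+r≡T = begin
    ∑ (λ ω → suffixSum d s ω * suffixSum d s ω) Ω
      ≡⟨ second-moment-step r s eq ⟩
    ∑ (λ ω → valueAt d s ω * valueAt d s ω) Ω + + 2 * (+ r * covariance 0 1) + _
      ≤⟨ +-mono-≤ (+-mono-≤ diagonal off-diagonal) (second-moment 0≤v d²≤v cov≤0 r (suc s) eq) ⟩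
    + length Ω * v + 0ℤ + + r * (+ length Ω * v)
      ≡⟨ cong (_+ + r * (+ length Ω * v)) (+-identityʳ (+ length Ω * v)) ⟩
    + length Ω * v + + r * (+ length Ω * v)
      ≡⟨ suc-* (+ r) (+ length Ω * v) ⟨
    + suc r * (+ length Ω * v) ∎
    where
    open ≤-Reasoning
    eq : suc s ℕ.+ r ≡ T
    eq = trans (sym (ℕ.+-suc s r)) s+r≡T
    diagonal : ∑ (λ ω → valueAt d s ω * valueAt d s ω) Ω ℤ.≤ + length Ω * v
    diagonal = ≤-trans (∑-mono-∈ Ω λ {ω} _ → valueAt²≤ d 0≤v d²≤v s ω) (≤-reflexive (∑-const v Ω))
    off-diagonal : + 2 * (+ r * covariance 0 1) ℤ.≤ 0ℤ
    off-diagonal = ≤-trans (*-monoˡ-≤-nonNeg (+ 2) (≤-trans (*-monoˡ-≤-nonNeg (+ r) cov≤0)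
      (≤-reflexive (*-zeroʳ (+ r))))) (≤-reflexive (*-zeroʳ (+ 2)))

  -- Negative correlation as in sampling without replacement.
  total≡0⇒covariance≤0 : ∀ {k} → T ≡ suc (suc k) → (∀ {s} → s ∈ Ω → ∑ d s ≡ 0ℤ) →
                          covariance 0 1 ℤ.≤ 0ℤ
  total≡0⇒covariance≤0 {k} T≡ total≡0 =
    *-cancelˡ-≤-pos (covariance 0 1) 0ℤ (+ suc k) (≤-trans (≤-from-difference
      (∑-nonneg Ω λ s → 0≤i*i (valueAt d 0 s)) eq) (≤-reflexive (sym (*-zeroʳ (+ suc k)))))
    where
    V = ∑ (λ s → valueAt d 0 s * valueAt d 0 s) Ω
    rearrange : ∀ x y → x + y ≡ 0ℤ → x ≡ 0ℤ - y
    rearrange x y x+y≡0 = trans (lemma x y) (cong (_- y) x+y≡0)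
      where
      lemma : ∀ x y → x ≡ x + y - y
      lemma = solve-∀
    -- Multiplying the vanishing total by the first entry and summing over `Ω` gives 0; the same sum
    -- is `V` plus `suc k` equal covariances.
    eq : V ≡ 0ℤ - + suc k * covariance 0 1
    eq = rearrange V _ (trans (cong (_+_ V) (sym (∑-value*suffixSum (suc k) 0 1 ℕ.z<s (sym T≡))))
      (trans (sym (∑-distrib-+ _ _ Ω))
      (trans (∑-cong-∈ Ω λ {s} s∈ →
                trans (sym (*-distribˡ-+ (valueAt d 0 s) (valueAt d 0 s) (suffixSum d 1 s)))
                (trans (cong (valueAt d 0 s *_) (trans (sym (suffixSum-step d 0 s)) (total≡0 s∈)))
                       (*-zeroʳ (valueAt d 0 s))))
             (∑-zero Ω))))

-- Independence: the sum over the first letter factors out, and `d` has mean zero.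
uniform-covariance : ∀ {m} {k} (d : Fin m → ℤ) → ∑ d (allFin m) ≡ 0ℤ →
  ∑ (λ s → valueAt d 0 s * valueAt d 1 s) (sequences m (suc k)) ≡ 0ℤ
uniform-covariance {m} {k} d ∑d≡0 =
  trans (∑-sequences-suc {m} k (λ s → valueAt d 0 s * valueAt d 1 s))
  (trans (∑-cong (allFin m) λ x → trans (∑-distribˡ-* (d x) (valueAt d 0) (sequences m k)) (*-comm (d x) E))
  (trans (∑-distribˡ-* E d (allFin m)) (trans (cong (E *_) ∑d≡0) (*-zeroʳ E))))
  where E = ∑ (valueAt d 0) (sequences m k)

-- Centred indicator of i under the uniform distribution, scaled by n to stay in ℤ.
deviation : ∀ {n} → Fin n → Fin n → ℤ
deviation {n} i x = + n * 𝟙 (i Fin.≟ x) - 1ℤ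

∑-deviation : ∀ {n} (i : Fin n) s → ∑ (deviation i) s ≡ + n * + occurrences i s - + length s
∑-deviation {n} i s = begin
  ∑ (deviation i) s
    ≡⟨ ∑-distrib-+ (λ x → + n * 𝟙 (i Fin.≟ x)) (λ _ → - 1ℤ) s ⟩
  ∑ (λ x → + n * 𝟙 (i Fin.≟ x)) s + ∑ (λ _ → - 1ℤ) s
    ≡⟨ cong₂ _+_ (trans (∑-distribˡ-* (+ n) _ s) (cong (+ n *_) (sym (length-filter-as-∑ (i Fin.≟_) s))))
                 (trans (∑-const (- 1ℤ) s) (trans (*-comm (+ length s) (- 1ℤ)) (-1*i≡-i _))) ⟩
  + n * + occurrences i s - + length s ∎
  where open ≡-Reasoning

occurrences-allFin : ∀ {n} (i : Fin n) → occurrences i (allFin n) ≡ 1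
occurrences-allFin {n} i =
  +-injective (trans (length-filter-as-∑ (i Fin.≟_) (allFin n)) (∑-≟ n i))

∑-deviation-allFin : ∀ {n} (i : Fin n) → ∑ (deviation i) (allFin n) ≡ 0ℤ
∑-deviation-allFin {n} i = trans (∑-deviation i (allFin n))
  (trans (cong₂ (λ o l → + n * + o - + l) (occurrences-allFin i) (List.length-tabulate id))
         (lemma (+ n)))
  where
  lemma : ∀ x → x * 1ℤ - x ≡ 0ℤ
  lemma = solve-∀

deviation²≤ : ∀ {n} (i x : Fin n) → deviation i x * deviation i x ℤ.≤ + n * + n
deviation²≤ {suc k} i x with i Fin.≟ x
... | yes _ = ≤-from-difference (0≤+ (2 ℕ.* k ℕ.+ 1))
  (trans (cong (_+ 1ℤ) (pos-* 2 k)) (lemma (+ k)))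
  where
  lemma : ∀ k → + 2 * k + 1ℤ ≡ (1ℤ + k) * (1ℤ + k) - ((1ℤ + k) * 1ℤ - 1ℤ) * ((1ℤ + k) * 1ℤ - 1ℤ)
  lemma = solve-∀
... | no  _ = ≤-from-difference (0≤i+j (0≤i*i (+ k)) (0≤i*j {+ 2} {+ k} (0≤+ 2) (0≤+ k))) (lemma (+ k))
  where
  lemma : ∀ k → k * k + + 2 * k ≡ (1ℤ + k) * (1ℤ + k) - ((1ℤ + k) * 0ℤ - 1ℤ) * ((1ℤ + k) * 0ℤ - 1ℤ)
  lemma = solve-∀

-- A balanced sequence, which shows that neither sample space is empty, so that `Pr` never takes its
-- dummy value.
blocks : ∀ m N → List (Fin m)
blocks m N = List.concat (List.replicate N (allFin m))

occurrences-blocks : ∀ m N (e : Fin m) → occurrences e (blocks m N) ≡ N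
occurrences-blocks m zero    e = refl
occurrences-blocks m (suc N) e =
  trans (cong length (List.filter-++ (e Fin.≟_) (allFin m) (blocks m N)))
  (trans (List.length-++ (filter (e Fin.≟_) (allFin m)))
         (cong₂ ℕ._+_ (occurrences-allFin e) (occurrences-blocks m N e)))

length-blocks : ∀ m N → length (blocks m N) ≡ N ℕ.* m
length-blocks m zero    = refl
length-blocks m (suc N) = trans (List.length-++ (allFin m))
  (cong₂ ℕ._+_ (List.length-tabulate id) (length-blocks m N))

blocks∈outcomes : ∀ M m N → blocks m N ∈ outcomes M m N
blocks∈outcomes uniform  m N =
  subst (λ k → blocks m N ∈ sequences m k) (length-blocks m N) (∈-sequences (blocks m N))
blocks∈outcomes balanced m N =
  ∈-filter⁺ (balanced? N) (blocks∈outcomes uniform m N) (occurrences-blocks m N)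

-- Uniform draws are independent, which gives covariance 0. In the balanced model `i` occurs exactly
-- `N` times among `N * n` draws, so its deviations add up to 0 along every outcome.
outcomes-covariance : ∀ M {n N k} (i : Fin n) → N ℕ.* n ≡ suc (suc k) →
  Moments.covariance (outcomes-exchangeable M n N) (deviation i) 0 1 ℤ.≤ 0ℤ
outcomes-covariance uniform {n} {N} {k} i T≡ =
  ≤-reflexive (subst (λ T → ∑ (λ s → valueAt (deviation i) 0 s * valueAt (deviation i) 1 s) (sequences n T) ≡ 0ℤ)
    (sym T≡)
    (uniform-covariance {k = suc k} (deviation i) (∑-deviation-allFin i)))
outcomes-covariance balanced {n} {N} i T≡ =
  Moments.total≡0⇒covariance≤0 (outcomes-exchangeable balanced n N) (deviation i) T≡ λ {s} s∈ →
    trans (∑-deviation i s)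
    (trans (cong₂ (λ o l → + n * + o - + l)
              (proj₂ (∈-filter⁻ (balanced? N) {xs = sequences n (N ℕ.* n)} s∈) i)
              (Exchangeable.length-∈ (outcomes-exchangeable balanced n N) s∈))
    (trans (cong (_-_ (+ n * + N)) (pos-* N n)) (lemma (+ n) (+ N))))
  where
  lemma : ∀ n N → n * N - N * n ≡ 0ℤ
  lemma = solve-∀

outcomes-second-moment : ∀ M {n N} (i : Fin n) → 2 ≤ N ℕ.* n → ∀ s → s ≤ N ℕ.* n →
  ∑ (λ ω → suffixSum (deviation i) s ω * suffixSum (deviation i) s ω) (outcomes M n N) ℤ.≤
  + (N ℕ.* n) * (+ length (outcomes M n N) * (+ n * + n))
outcomes-second-moment M {n} {N} i 2≤T s s≤T = ≤-trans
  (Moments.second-moment (outcomes-exchangeable M n N) (deviation i) (0≤i*i (+ n)) (deviation²≤ i)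
    (outcomes-covariance M {n} {N} i (sym (ℕ.m+[n∸m]≡n 2≤T))) (N ℕ.* n ∸ s) s (ℕ.m+[n∸m]≡n s≤T))
  (*-monoʳ-≤-nonNeg (+ length (outcomes M n N) * (+ n * + n))
    {{nonNegative (0≤i*j (0≤+ (length (outcomes M n N))) (0≤i*i (+ n)))}}
    (+≤+ (ℕ.m∸n≤m (N ℕ.* n) s)))

-- Levels of the process on the dual of K n

minimum-≡ : ∀ {x} xs → x ∈ xs → (∀ {y} → y ∈ xs → x ≤ y) → minimum xs ≡ x
minimum-≡ {x} (z ∷ zs) x∈ x≤ = ℕ.≤-antisym
  (min≤v⁺ z zs (below x∈))
  (v≤min⁺ (x≤ (here refl)) (All.tabulate (x≤ ∘ there)))
  where
  below : x ∈ z ∷ zs → z ≤ x ⊎ Any.Any (_≤ x) zs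
  below (here refl) = inj₁ ℕ.≤-refl
  below (there x∈)  = inj₂ (Any.map (ℕ.≤-reflexive ∘ sym) x∈)

occurrences-++ : ∀ {n} (i : Fin n) xs ys →
                 occurrences i (xs ++ ys) ≡ occurrences i xs ℕ.+ occurrences i ys
occurrences-++ i xs ys = trans (cong length (List.filter-++ (i Fin.≟_) xs ys))
                               (List.length-++ (filter (i Fin.≟_) xs))

occurrences-≡ : ∀ {n} (i : Fin n) → occurrences i (i ∷ []) ≡ 1
occurrences-≡ i = cong length (List.filter-accept (i Fin.≟_) {xs = []} refl)

occurrences-≢ : ∀ {n} {i j : Fin n} → i ≢ j → occurrences i (j ∷ []) ≡ 0
occurrences-≢ {i = i} i≢j = cong length (List.filter-reject (i Fin.≟_) {xs = []} i≢j)

occurrences-drop : ∀ {n} (i : Fin n) r ys zs → r ≤ length ys →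
                   occurrences i zs ≤ occurrences i (drop r (ys ++ zs))
occurrences-drop i zero    ys       zs _ =
  subst (occurrences i zs ≤_) (sym (occurrences-++ i ys zs)) (ℕ.m≤n+m _ _)
occurrences-drop i (suc r) (y ∷ ys) zs (ℕ.s≤s r≤) = occurrences-drop i r ys zs r≤

-- The increment is written as an occurrence count so that it agrees with the growth of
-- `occurrences k zs` in the field `split` when a draw is appended.
bump : ∀ {n} → Fin n → (Fin n → ℕ) → Fin n → ℕ
bump i h j = h j ℕ.+ occurrences j (i ∷ [])

bump-≡ : ∀ {n} (i : Fin n) h → bump i h i ≡ suc (h i)
bump-≡ i h = trans (cong (h i ℕ.+_) (occurrences-≡ i)) (ℕ.+-comm (h i) 1)

bump-≢ : ∀ {n} {i j : Fin n} h → j ≢ i → bump i h j ≡ h j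
bump-≢ {j = j} h j≢i = trans (cong (h j ℕ.+_) (occurrences-≢ j≢i)) (ℕ.+-identityʳ (h j))

∑-bump : ∀ {n} (i : Fin n) h → ∑ (λ j → + bump i h j) (allFin n) ≡ ∑ (λ j → + h j) (allFin n) + 1ℤ
∑-bump {n} i h = trans (∑-distrib-+ (λ j → + h j) (λ j → + occurrences j (i ∷ [])) (allFin n))
  (cong (_+_ (∑ (λ j → + h j) (allFin n)))
    (trans (∑-cong (allFin n) λ j → trans (length-filter-as-∑ (j Fin.≟_) (i ∷ []))
             (trans (+-identityʳ _) (𝟙-⇔ (j Fin.≟ i) (i Fin.≟ j) sym sym)))
           (∑-≟ n i)))

module Process (n : ℕ) where

  H : Hypergraph
  H = dual (K n)

  open CU H

  end₁ end₂ : Fin (#V H) → Fin n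
  end₁ v = proj₁ (lookup (pairs n) v)
  end₂ v = proj₂ (lookup (pairs n) v)

  end₁≢end₂ : ∀ v → end₁ v ≢ end₂ v
  end₁≢end₂ v = Fin.<⇒≢ (proj₂
    (∈-filter⁻ (uncurry Fin._<?_) {xs = List.cartesianProduct (allFin n) (allFin n)}
               (∈-lookup {xs = pairs n} v)))

  incident⁺ : ∀ i v → i ≡ end₁ v ⊎ i ≡ end₂ v → v Subset.∈ edge H i
  incident⁺ i v i∈v = Vec.lookup⇒[]= v (edge H i)
    (trans (Vec.lookup∘tabulate _ v) (dec-true (i ∈? edge (K n) v) (x∈p∪q⁺ (singletons i∈v))))
    where
    singletons : i ≡ end₁ v ⊎ i ≡ end₂ v → i Subset.∈ Subset.⁅ end₁ v ⁆ ⊎ i Subset.∈ Subset.⁅ end₂ v ⁆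
    singletons (inj₁ refl) = inj₁ (x∈⁅x⁆ _)
    singletons (inj₂ refl) = inj₂ (x∈⁅x⁆ _)

  incident⁻ : ∀ i v → v Subset.∈ edge H i → i ≡ end₁ v ⊎ i ≡ end₂ v
  incident⁻ i v v∈ with i ∈? edge (K n) v in eq
  ... | no i∉ = contradiction
    (trans (sym (Vec.[]=⇒lookup v∈)) (trans (Vec.lookup∘tabulate _ v) (cong does eq))) λ ()
  ... | yes i∈ with x∈p∪q⁻ Subset.⁅ end₁ v ⁆ Subset.⁅ end₂ v ⁆ i∈
  ...   | inj₁ i∈₁ = inj₁ (x∈⁅y⁆⇒x≡y _ i∈₁)
  ...   | inj₂ i∈₂ = inj₂ (x∈⁅y⁆⇒x≡y _ i∈₂)

  vertex-< : ∀ {i j} → i Fin.< j → ∃ λ v → end₁ v ≡ i × end₂ v ≡ j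
  vertex-< {i} {j} i<j =
    Any.index ij∈ , sym (cong proj₁ (Any.lookup-index ij∈)) , sym (cong proj₂ (Any.lookup-index ij∈))
    where
    ij∈ : (i , j) ∈ pairs n
    ij∈ = ∈-filter⁺ (uncurry Fin._<?_) (∈-cartesianProduct⁺ (∈-allFin i) (∈-allFin j)) i<j

  maxEnds : (Fin n → ℕ) → Fin (#V H) → ℕ
  maxEnds h v = h (end₁ v) ℕ.⊔ h (end₂ v)

  -- Pairs are listed with the smaller index first; the symmetric `maxEnds` hides which of `i` and
  -- `j` that is.
  vertex-≢ : ∀ {i j} → i ≢ j → ∃ λ v →
    (i ≡ end₁ v ⊎ i ≡ end₂ v) × (∀ h → maxEnds h v ≡ h i ℕ.⊔ h j)
  vertex-≢ {i} {j} i≢j with Fin.<-cmp i j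
  ... | tri< i<j _ _ = let v , eq₁ , eq₂ = vertex-< i<j in
    v , inj₁ (sym eq₁) , λ h → cong₂ (λ x y → h x ℕ.⊔ h y) eq₁ eq₂
  ... | tri≈ _ i≡j _ = contradiction i≡j i≢j
  ... | tri> _ _ j<i = let v , eq₁ , eq₂ = vertex-< j<i in
    v , inj₂ (sym eq₂) , λ h → trans (cong₂ (λ x y → h x ℕ.⊔ h y) eq₁ eq₂) (ℕ.⊔-comm (h j) (h i))

  -- Every vertex on the edge `i` has a counter of at least `h i`, since `i` is one of its ends. The
  -- pair of `i` with any `j` of no higher level attains this value.
  edgeCounter-≡ : ∀ c h {i j} → (∀ v → c v ≡ maxEnds h v) → i ≢ j → h j ≤ h i → edgeCounter c i ≡ h i
  edgeCounter-≡ c h {i} {j} c≡ i≢j hj≤hi = minimum-≡ _ attained below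
    where
    incident = filter (_∈? edge H i) (allFin (#V H))
    attained : h i ∈ List.map c incident
    attained with v , i∈v , max≡ ← vertex-≢ i≢j =
      subst (_∈ List.map c incident)
            (trans (c≡ v) (trans (max≡ h) (ℕ.m≥n⇒m⊔n≡m hj≤hi)))
            (∈-map⁺ c (∈-filter⁺ (_∈? edge H i) (∈-allFin v) (incident⁺ i v i∈v)))
    below : ∀ {y} → y ∈ List.map c incident → h i ≤ y
    below y∈ with v , v∈ , refl ← ∈-map⁻ c y∈
      with incident⁻ i v (proj₂ (∈-filter⁻ (_∈? edge H i) {xs = allFin (#V H)} v∈))
    ... | inj₁ refl = ℕ.≤-trans (ℕ.m≤m⊔n _ _) (ℕ.≤-reflexive (sym (c≡ v)))
    ... | inj₂ refl = ℕ.≤-trans (ℕ.m≤n⊔m _ _) (ℕ.≤-reflexive (sym (c≡ v)))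

  step-minimal : ∀ c i v → v Subset.∈ edge H i → c v ≡ edgeCounter c i → step c i v ≡ suc (c v)
  step-minimal c i v v∈ c≡ = cong (λ b → if b then suc (c v) else c v)
    (dec-true ((v ∈? edge H i) ×-dec (c v ℕ.≟ edgeCounter c i)) (v∈ , c≡))

  step-other : ∀ c i v → ¬ (v Subset.∈ edge H i × c v ≡ edgeCounter c i) → step c i v ≡ c v
  step-other c i v ¬min = cong (λ b → if b then suc (c v) else c v)
    (dec-false ((v ∈? edge H i) ×-dec (c v ℕ.≟ edgeCounter c i)) ¬min)

  -- If `h y ≤ h x`, the vertex is minimal on the edge and rises together with `h x`. Otherwise it
  -- stays, and raising `h x` by one does not push it above `h y`. Stating this for `x` and `y`
  -- serves both orders of the ends.
  max-bump : ∀ c i h v x y → c v ≡ h x ℕ.⊔ h y → edgeCounter c i ≡ h i → i ≡ x → x ≢ y →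
             v Subset.∈ edge H i → step c i v ≡ bump i h x ℕ.⊔ bump i h y
  max-bump c i h v x y c≡ ec≡ refl x≢y v∈ with h y ℕ.≤? h x
  ... | yes hy≤hx = trans (step-minimal c i v v∈ (trans cv≡ (sym ec≡)))
        (trans (cong suc cv≡) (sym (trans (cong₂ ℕ._⊔_ (bump-≡ i h) (bump-≢ h (x≢y ∘ sym)))
                      (ℕ.m≥n⇒m⊔n≡m (ℕ.m≤n⇒m≤1+n hy≤hx)))))
    where
    cv≡ : c v ≡ h x
    cv≡ = trans c≡ (ℕ.m≥n⇒m⊔n≡m hy≤hx)
  ... | no hy≰hx =
        trans (step-other c i v λ (_ , cv≡ec) →
                 ℕ.<⇒≢ (ℕ.≰⇒> hy≰hx) (trans (sym ec≡) (trans (sym cv≡ec) cv≡)))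
          (trans cv≡ (sym (trans (cong₂ ℕ._⊔_ (bump-≡ i h) (bump-≢ h (x≢y ∘ sym)))
                                 (ℕ.m≤n⇒m⊔n≡n (ℕ.≰⇒> hy≰hx)))))
    where
    cv≡ : c v ≡ h y
    cv≡ = trans c≡ (ℕ.m≤n⇒m⊔n≡n (ℕ.<⇒≤ (ℕ.≰⇒> hy≰hx)))

  step-maxEnds : ∀ c h i → (∀ v → c v ≡ maxEnds h v) → edgeCounter c i ≡ h i →
                 ∀ v → step c i v ≡ maxEnds (bump i h) v
  step-maxEnds c h i c≡ ec≡ v with i Fin.≟ end₁ v | i Fin.≟ end₂ v
  ... | yes i≡₁ | _ = max-bump c i h v _ _ (c≡ v) ec≡ i≡₁ (end₁≢end₂ v) (incident⁺ i v (inj₁ i≡₁))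
  ... | no _ | yes i≡₂ = trans
    (max-bump c i h v _ _ (trans (c≡ v) (ℕ.⊔-comm (h (end₁ v)) (h (end₂ v)))) ec≡ i≡₂
              (end₁≢end₂ v ∘ sym) (incident⁺ i v (inj₂ i≡₂)))
    (ℕ.⊔-comm (bump i h (end₂ v)) (bump i h (end₁ v)))
  ... | no i≢₁ | no i≢₂ = trans (step-other c i v λ (v∈ , _) → neither (incident⁻ i v v∈))
    (trans (c≡ v) (sym (cong₂ ℕ._⊔_ (bump-≢ h (i≢₁ ∘ sym)) (bump-≢ h (i≢₂ ∘ sym)))))
    where
    neither : ¬ (i ≡ end₁ v ⊎ i ≡ end₂ v)
    neither (inj₁ eq) = i≢₁ eq
    neither (inj₂ eq) = i≢₂ eq

  -- The other end of any pair containing `b` is strictly higher, so it still determines the maximum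
  -- after `b` has gone up by one.
  maxEnds-raise : ∀ h b → (∀ k → k ≢ b → h b ℕ.< h k) → ∀ v → maxEnds (bump b h) v ≡ maxEnds h v
  maxEnds-raise h b unique v with b Fin.≟ end₁ v | b Fin.≟ end₂ v
  ... | no b≢₁ | no b≢₂ = cong₂ ℕ._⊔_ (bump-≢ h (b≢₁ ∘ sym)) (bump-≢ h (b≢₂ ∘ sym))
  ... | yes refl | _ = trans (cong₂ ℕ._⊔_ (bump-≡ b h) (bump-≢ h (end₁≢end₂ v ∘ sym)))
        (trans (ℕ.m≤n⇒m⊔n≡n lt) (sym (ℕ.m≤n⇒m⊔n≡n (ℕ.<⇒≤ lt))))
    where lt = unique (end₂ v) (end₁≢end₂ v ∘ sym)
  ... | no _ | yes refl = trans (cong₂ ℕ._⊔_ (bump-≢ h (end₁≢end₂ v)) (bump-≡ b h))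
        (trans (ℕ.m≥n⇒m⊔n≡m lt) (sym (ℕ.m≥n⇒m⊔n≡m (ℕ.<⇒≤ lt))))
    where lt = unique (end₁ v) (end₁≢end₂ v)

  -- Here `base` is only a lower bound for the levels, so that the record also describes the moment
  -- between a draw and the free rise that follows it, when a single index may be left at the base.
  record Levels (s : List (Fin n)) (c : Counters) (h : Fin n → ℕ) (base : ℕ) : Set where
    field
      base≤   : ∀ k → base ≤ h k
      counter : ∀ v → c v ≡ maxEnds h v
      total   : ∑ (λ k → + h k) (allFin n) ≡ + length s + + base
      -- Up to the end of ys, k was last at the base; since then only draws of k raised it.
      split   : ∀ k → ∃₂ λ ys zs → ys ++ zs ≡ s ×
                (n ∸ 1) ℕ.* h k ≤ length ys ℕ.+ (n ∸ 1) ℕ.* occurrences k zs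

  -- The new draw joins the second part of each split. It adds the same amount to both sides of the
  -- inequality, namely `n ∸ 1` if `k` is the drawn index and 0 otherwise.
  draw : ∀ {s c h base} i → Levels s c h base → edgeCounter c i ≡ h i →
         Levels (s ∷ʳ i) (step c i) (bump i h) base
  draw {s} {c} {h} {base} i L ec≡ = record
    { base≤   = λ k → ℕ.≤-trans (base≤ k) (ℕ.m≤m+n _ _)
    ; counter = step-maxEnds c h i counter ec≡
    ; total   = trans (∑-bump i h) (trans (cong (_+ 1ℤ) total)
        (trans (lemma (+ length s) (+ base)) (cong (λ l → + l + + base) (sym (List.length-++ s)))))
    ; split   = λ k → let ys , zs , eq , le = split k in
        ys , zs ∷ʳ i , trans (sym (List.++-assoc ys zs (i ∷ []))) (cong (_∷ʳ i) eq) , bound k ys zs le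
    }
    where
    open Levels L
    lemma : ∀ x y → x + y + 1ℤ ≡ x + 1ℤ + y
    lemma = solve-∀
    bound : ∀ k ys zs → (n ∸ 1) ℕ.* h k ≤ length ys ℕ.+ (n ∸ 1) ℕ.* occurrences k zs →
      (n ∸ 1) ℕ.* bump i h k ≤ length ys ℕ.+ (n ∸ 1) ℕ.* occurrences k (zs ∷ʳ i)
    bound k ys zs le = begin
      n-1 ℕ.* (h k ℕ.+ δ)                             ≡⟨ ℕ.*-distribˡ-+ n-1 (h k) δ ⟩
      n-1 ℕ.* h k ℕ.+ n-1 ℕ.* δ                       ≤⟨ ℕ.+-monoˡ-≤ (n-1 ℕ.* δ) le ⟩
      length ys ℕ.+ n-1 ℕ.* o ℕ.+ n-1 ℕ.* δ           ≡⟨ ℕ.+-assoc (length ys) _ _ ⟩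
      length ys ℕ.+ (n-1 ℕ.* o ℕ.+ n-1 ℕ.* δ)         ≡⟨ cong (length ys ℕ.+_) (sym (ℕ.*-distribˡ-+ n-1 o δ)) ⟩
      length ys ℕ.+ n-1 ℕ.* (o ℕ.+ δ)                 ≡⟨ cong (λ z → length ys ℕ.+ n-1 ℕ.* z)
                                                              (sym (occurrences-++ k zs (i ∷ []))) ⟩
      length ys ℕ.+ n-1 ℕ.* occurrences k (zs ∷ʳ i)   ∎
      where
      open ℕ.≤-Reasoning
      n-1 = n ∸ 1
      δ = occurrences k (i ∷ [])
      o = occurrences k zs

  -- All `n` levels are at least `base`, so `n * base` is at most the total, `length s + base`.
  base-bound : ∀ {s : List (Fin n)} (h : Fin n → ℕ) base → (∀ k → base ≤ h k) →
    ∑ (λ k → + h k) (allFin n) ≡ + length s + + base → (n ∸ 1) ℕ.* base ≤ length s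
  base-bound {s} h base base≤ total = begin
    (n ∸ 1) ℕ.* base      ≡⟨ ℕ.*-distribʳ-∸ base n 1 ⟩
    n ℕ.* base ∸ (base ℕ.+ 0) ≡⟨ cong (n ℕ.* base ∸_) (ℕ.+-identityʳ base) ⟩
    n ℕ.* base ∸ base     ≤⟨ ℕ.∸-monoˡ-≤ base n*base≤ ⟩
    length s ℕ.+ base ∸ base  ≡⟨ ℕ.m+n∸n≡m (length s) base ⟩
    length s ∎
    where
    open ℕ.≤-Reasoning
    n*base≤ : n ℕ.* base ≤ length s ℕ.+ base
    n*base≤ = drop‿+≤+ (≤-trans (≤-reflexive (trans (pos-* n base)
        (sym (trans (∑-const (+ base) (allFin n))
                    (cong (λ l → + l * + base) (List.length-tabulate (id {A = Fin n})))))))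
      (≤-trans (∑-mono-∈ (allFin n) λ {k} _ → +≤+ (base≤ k)) (≤-reflexive total)))

  -- The free pass: the total and the base both grow by one while no edge is drawn and no counter
  -- moves.
  raise : ∀ {s c h base} b → Levels s c h base → h b ≡ base → (∀ k → k ≢ b → base ℕ.< h k) →
          Levels s c (bump b h) (suc base)
  raise {s} {c} {h} {base} b L refl unique = record
    { base≤   = base≤′
    ; counter = λ v → trans (counter v) (sym (maxEnds-raise h b unique v))
    ; total   = total′
    ; split   = split′
    }
    where
    open Levels L
    base≤′ : ∀ k → suc base ≤ bump b h k
    base≤′ k = case k Fin.≟ b of λ where
      (yes refl) → ℕ.≤-reflexive (sym (bump-≡ b h))
      (no  k≢b)  → ℕ.≤-trans (unique k k≢b) (ℕ.m≤m+n _ _)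
    lemma : ∀ x y → x + y + 1ℤ ≡ x + (1ℤ + y)
    lemma = solve-∀
    total′ : ∑ (λ k → + bump b h k) (allFin n) ≡ + length s + + suc base
    total′ = trans (∑-bump b h) (trans (cong (_+ 1ℤ) total) (lemma (+ length s) (+ base)))
    split′ : ∀ k → ∃₂ λ ys zs → ys ++ zs ≡ s ×
             (n ∸ 1) ℕ.* bump b h k ≤ length ys ℕ.+ (n ∸ 1) ℕ.* occurrences k zs
    split′ k = case_of_ {A = Dec (k ≡ b)} (k Fin.≟ b) λ where
      -- Index `b` now lies at the new base, so its split is reset to the present moment, where
      -- `base-bound` is the required inequality.
      (yes refl) → s , [] , List.++-identityʳ s , ℕ.≤-trans
        (ℕ.≤-reflexive (cong ((n ∸ 1) ℕ.*_) (bump-≡ b h)))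
        (ℕ.≤-trans (base-bound {s} (bump b h) (suc base) base≤′ total′)
                 (ℕ.m≤m+n (length s) ((n ∸ 1) ℕ.* occurrences k [])))
      (no k≢b)   → let ys , zs , eq , le = split k in
        ys , zs , eq , ℕ.≤-trans (ℕ.≤-reflexive (cong ((n ∸ 1) ℕ.*_) (bump-≢ h k≢b))) le

  record Profile (s : List (Fin n)) (c : Counters) : Set where
    field
      {level}   : Fin n → ℕ
      {base}    : ℕ
      levels    : Levels s c level base
      {a b}     : Fin n
      a≢b       : a ≢ b
      level-a   : level a ≡ base
      level-b   : level b ≡ base
    open Levels levels public

    -- At least one of `a` and `b` differs from `i`; being at the base, it can serve as the lower
    -- partner of `i`.
    edgeCounter-level : ∀ i → edgeCounter c i ≡ level i
    edgeCounter-level i with i Fin.≟ a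
    ... | no  i≢a  = edgeCounter-≡ c level counter i≢a (subst (_≤ level i) (sym level-a) (base≤ i))
    ... | yes refl = edgeCounter-≡ c level counter a≢b (subst (_≤ level i) (sym level-b) (base≤ i))

    third? : Dec (∃ λ k → k ≢ a × k ≢ b × level k ≡ base)
    third? = Fin.any? λ k → ¬? (k Fin.≟ a) ×-dec ¬? (k Fin.≟ b) ×-dec (level k ℕ.≟ base)

  -- When `a` leaves the base, a third index `k` at the base keeps the minimum attained twice.
  -- Without one, `b` is left alone there and passes for free, so that `a` and `b` meet again one
  -- level higher.
  advance-minimal : ∀ {s c} (P : Profile s c) → let open Profile P in Profile (s ∷ʳ a) (step c a)
  advance-minimal P with Profile.third? P
  ... | yes (k , k≢a , k≢b , level-k) = record
    { levels  = draw a levels (edgeCounter-level a)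
    ; a≢b     = k≢b
    ; level-a = trans (bump-≢ level k≢a) level-k
    ; level-b = trans (bump-≢ level (a≢b ∘ sym)) level-b
    }
    where open Profile P
  ... | no ¬third = record
    { levels  = raise b (draw a levels (edgeCounter-level a)) b≡base unique
    ; a≢b     = a≢b
    ; level-a = trans (bump-≢ (bump a level) a≢b) (trans (bump-≡ a level) (cong suc level-a))
    ; level-b = trans (bump-≡ b (bump a level)) (cong suc b≡base)
    }
    where
    open Profile P
    b≡base = trans (bump-≢ level (a≢b ∘ sym)) level-b
    unique : ∀ k → k ≢ b → base ℕ.< bump a level k
    unique k k≢b = case k Fin.≟ a of λ where
      (yes refl) → ℕ.≤-reflexive (sym (trans (bump-≡ a level) (cong suc level-a)))
      (no  k≢a)  → ℕ.≤-trans (ℕ.≤∧≢⇒< (base≤ k) λ eq → ¬third (k , k≢a , k≢b , sym eq)) (ℕ.m≤m+n _ _)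

  advance : ∀ {s c} → Profile s c → ∀ i → Profile (s ∷ʳ i) (step c i)
  advance {s} {c} P i with i Fin.≟ Profile.a P | i Fin.≟ Profile.b P
  ... | yes refl | _        = advance-minimal P
  ... | no _     | yes refl = advance-minimal record
    { levels = levels ; a≢b = a≢b ∘ sym ; level-a = level-b ; level-b = level-a }
    where open Profile P
  ... | no i≢a   | no i≢b   = record
    { levels  = draw i levels (edgeCounter-level i)
    ; a≢b     = a≢b
    ; level-a = trans (bump-≢ level (i≢a ∘ sym)) level-a
    ; level-b = trans (bump-≢ level (i≢b ∘ sym)) level-b
    }
    where open Profile P

  run : ∀ {ys c} zs → Profile ys c → Profile (ys ++ zs) (foldl step c zs)
  run {ys} {c} []       P = subst (λ s → Profile s c) (sym (List.++-identityʳ ys)) P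
  run {ys} {c} (z ∷ zs) P =
    subst (λ s → Profile s (foldl step (step c z) zs)) (List.++-assoc ys (z ∷ []) zs) (run zs (advance P z))

profile : ∀ k s → Process.Profile (suc (suc k)) s (CU.counters (dual (K (suc (suc k)))) s)
profile k s = run s record
  { levels  = record
    { base≤   = λ _ → ℕ.z≤n
    ; counter = λ _ → refl
    ; total   = ∑-zero (allFin (suc (suc k)))
    ; split   = λ _ → [] , [] , refl , ℕ.≤-reflexive (trans (ℕ.*-zeroʳ (suc k)) (sym (ℕ.*-zeroʳ (suc k))))
    }
  ; a≢b     = Fin.0≢1+n {i = Fin.zero}
  ; level-a = refl
  ; level-b = refl
  }
  where open Process (suc (suc k))

-- Levels under nearly equidistributed draws

n≤n/d*d+d : ∀ n d .{{_ : ℕ.NonZero d}} → n ≤ n ℕ./ d ℕ.* d ℕ.+ d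
n≤n/d*d+d n d = begin
  n                         ≡⟨ m≡m%n+[m/n]*n n d ⟩
  n ℕ.% d ℕ.+ n ℕ./ d ℕ.* d   ≤⟨ ℕ.+-monoˡ-≤ (n ℕ./ d ℕ.* d) (ℕ.<⇒≤ (m%n<n n d)) ⟩
  d ℕ.+ n ℕ./ d ℕ.* d         ≡⟨ ℕ.+-comm d _ ⟩
  n ℕ./ d ℕ.* d ℕ.+ d         ∎
  where open ℕ.≤-Reasoning

-- Cut positions about `N / P` draws apart. For `j ≤ P * n` they cover a run of `N * n` draws, and
-- their number does not grow with `N`, so summing over them costs only a constant factor.
checkpoint : (N P : ℕ) .{{_ : ℕ.NonZero P}} → ℕ → ℕ
checkpoint N P j = j ℕ.* N ℕ./ P

checkpoint-≤ : ∀ N P n j .{{_ : ℕ.NonZero P}} → j ≤ P ℕ.* n → checkpoint N P j ≤ N ℕ.* n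
checkpoint-≤ N P n j j≤Pn = begin
  j ℕ.* N ℕ./ P             ≤⟨ /-monoˡ-≤ P (ℕ.*-monoˡ-≤ N j≤Pn) ⟩
  P ℕ.* n ℕ.* N ℕ./ P       ≡⟨ cong (ℕ._/ P) (trans (ℕ.*-assoc P n N)
                               (trans (ℕ.*-comm P _) (cong (ℕ._* P) (ℕ.*-comm n N)))) ⟩
  N ℕ.* n ℕ.* P ℕ./ P       ≡⟨ m*n/n≡m (N ℕ.* n) P ⟩
  N ℕ.* n                 ∎
  where open ℕ.≤-Reasoning

module Deterministic (k N P : ℕ) .{{_ : ℕ.NonZero N}} .{{_ : ℕ.NonZero P}} (P≤N : P ≤ N) where

  m n T : ℕ
  m = suc k
  n = suc (suc k)
  T = N ℕ.* n

  -- Two roundings occur. Measured after multiplication by `P`, rounding down to a multiple of `N`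
  -- loses at most `N`, and rounding the checkpoint itself loses at most `P ≤ N`.
  checkpoint-below : ∀ s → s ≤ T → ∃ λ j → j ≤ P ℕ.* n × checkpoint N P j ≤ s ×
                     s ℕ.* P ≤ checkpoint N P j ℕ.* P ℕ.+ 2 ℕ.* N
  checkpoint-below s s≤T =
    j , j≤Pn , ℕ.*-cancelʳ-≤ r s P (ℕ.≤-trans (m/n*n≤m (j ℕ.* N) P) (m/n*n≤m (s ℕ.* P) N)) , gap
    where
    open ℕ.≤-Reasoning
    j = s ℕ.* P ℕ./ N
    r = checkpoint N P j
    j≤Pn : j ≤ P ℕ.* n
    j≤Pn = begin
      s ℕ.* P ℕ./ N              ≤⟨ /-monoˡ-≤ N (ℕ.*-monoˡ-≤ P s≤T) ⟩
      T ℕ.* P ℕ./ N              ≡⟨ cong (ℕ._/ N) (trans (ℕ.*-comm T P)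
                                    (trans (cong (P ℕ.*_) (ℕ.*-comm N n)) (sym (ℕ.*-assoc P n N)))) ⟩
      P ℕ.* n ℕ.* N ℕ./ N        ≡⟨ m*n/n≡m (P ℕ.* n) N ⟩
      P ℕ.* n                  ∎
    gap : s ℕ.* P ≤ r ℕ.* P ℕ.+ 2 ℕ.* N
    gap = begin
      s ℕ.* P                  ≤⟨ n≤n/d*d+d (s ℕ.* P) N ⟩
      j ℕ.* N ℕ.+ N            ≤⟨ ℕ.+-monoˡ-≤ N (n≤n/d*d+d (j ℕ.* N) P) ⟩
      r ℕ.* P ℕ.+ P ℕ.+ N      ≤⟨ ℕ.+-monoˡ-≤ N (ℕ.+-monoʳ-≤ (r ℕ.* P) P≤N) ⟩
      r ℕ.* P ℕ.+ N ℕ.+ N      ≡⟨ ℕ.+-assoc (r ℕ.* P) N N ⟩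
      r ℕ.* P ℕ.+ (N ℕ.+ N)    ≡⟨ cong (λ z → r ℕ.* P ℕ.+ (N ℕ.+ z)) (sym (ℕ.+-identityʳ N)) ⟩
      r ℕ.* P ℕ.+ 2 ℕ.* N      ∎

  Regular : List (Fin n) → Set
  Regular ω = ∀ i j → j ≤ P ℕ.* n →
    + P * suffixSum (deviation i) (checkpoint N P j) ω ℤ.≤ + N ×
    + P * - suffixSum (deviation i) (checkpoint N P j) ω ℤ.≤ + N

  module _ {ω : List (Fin n)} {c} (profile : Process.Profile n ω c)
           (length≡ : length ω ≡ T) (regular : Regular ω) where

    open Process.Profile profile

    suffixSum-occurrences : ∀ i r → r ≤ T →
      suffixSum (deviation i) r ω ≡ + n * + occurrences i (drop r ω) - (+ T - + r)
    suffixSum-occurrences i r r≤T = trans (∑-deviation i (drop r ω))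
      (cong (λ z → + n * + occurrences i (drop r ω) - z)
        (trans (cong +_ (trans (List.length-drop r ω) (cong (_∸ r) length≡)))
               (sym (trans (m-n≡m⊖n T r) (⊖-≥ r≤T)))))

    -- Up to the cut of the split the level has grown at rate at most `1 / m`, and after it only by
    -- draws of `i`, at a rate close to `1 / n`. The latter is smaller, so the worst case is a cut
    -- at the very end, which gives `T / m`.
    level-upper : ∀ i → + P * (+ m * + level i) ℤ.≤ + P * + T + + 3 * + N
    level-upper i with ys , zs , refl , le ← split i
      with j , j≤ , r≤s , gap ← checkpoint-below (length ys)
             (subst (length ys ≤_) length≡ (List.length-++-≤ˡ ys)) =
      -- After scaling by `n` the slacks combine linearly. Regularity costs `m * N` and the move to
      -- a checkpoint `2 * m * N`; the final `3 * N` pads the sum `3 * m * N` to `3 * n * N`.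
      *-cancelˡ-≤-pos _ _ (+ n) (≤-from-difference
        (0≤i+j (0≤i+j (0≤i+j (0≤i+j (0≤i+j
          (0≤i*j (0≤i*j (0≤+ n) (0≤+ P)) e₁)
          (0≤i*j (0≤i*j (0≤i*j (0≤+ n) (0≤+ P)) (0≤+ m)) e₂))
          (0≤i*j (0≤+ m) e₃))
          (0≤i*j (0≤+ m) e₄))
          (0≤i*j (0≤+ P) e₅))
          (0≤i*j (0≤+ 3) (0≤+ N)))
        (lemma (+ m) (+ N) (+ P) (+ T) (+ s) (+ r) (+ occurrences i zs) (+ O) (+ level i)))
      where
      s = length ys
      r = checkpoint N P j
      O = occurrences i (drop r (ys ++ zs))
      s≤T : s ≤ T
      s≤T = subst (s ≤_) length≡ (List.length-++-≤ˡ ys)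
      e₁ : 0ℤ ℤ.≤ + s + + m * + occurrences i zs - + m * + level i
      e₁ = i≤j⇒0≤j-i (≤-trans (≤-reflexive (sym (pos-* m _)))
             (≤-trans (+≤+ le) (≤-reflexive (cong (_+_ (+ s)) (pos-* m _)))))
      e₂ : 0ℤ ℤ.≤ + O - + occurrences i zs
      e₂ = i≤j⇒0≤j-i (+≤+ (occurrences-drop i r ys zs r≤s))
      e₃ : 0ℤ ℤ.≤ + N - + P * ((1ℤ + + m) * + O - (+ T - + r))
      e₃ = i≤j⇒0≤j-i (subst (λ z → + P * z ℤ.≤ + N) (suffixSum-occurrences i r (ℕ.≤-trans r≤s s≤T))
             (proj₁ (regular i j j≤)))
      e₄ : 0ℤ ℤ.≤ + r * + P + + 2 * + N - + s * + P
      e₄ = i≤j⇒0≤j-i (≤-trans (≤-reflexive (sym (pos-* s P)))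
             (≤-trans (+≤+ gap) (≤-reflexive (cong₂ _+_ (pos-* r P) (pos-* 2 N)))))
      e₅ : 0ℤ ℤ.≤ + T - + s
      e₅ = i≤j⇒0≤j-i (+≤+ s≤T)
      lemma : ∀ m N P T s r z O h →
        (1ℤ + m) * P * (s + m * z - m * h) + (1ℤ + m) * P * m * (O - z)
        + m * (N - P * ((1ℤ + m) * O - (T - r))) + m * (r * P + + 2 * N - s * P) + P * (T - s) + + 3 * N
        ≡ (1ℤ + m) * (P * T + + 3 * N) - (1ℤ + m) * (P * (m * h))
      lemma = solve-∀

    -- The gaps of the levels below their upper bound `U` are non-negative, and `a` and `b` both
    -- have the gap of the base, so all gaps together are at least `2 * base-gap`. Since the levels
    -- add up to `T + base`, this bounds the base from below.
    base-lower : + P * + T - + 3 * + n * + N ℤ.≤ + P * (+ m * + base)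
    -- The argument itself yields the error `3 * k * N` with `k = n - 2`; the term `6 * N` pads it
    -- to `3 * n * N`.
    base-lower = ≤-from-difference (0≤i+j slack (0≤i*j {+ 6} {+ N} (0≤+ 6) (0≤+ N)))
      (trans (cong (_+ + 6 * + N) (cong₂ _-_ sum≡ doubled≡))
        (lemma (+ k) (+ N) (+ P) (+ T) (+ base)))
      where
      U = + P * + T + + 3 * + N
      gap : Fin n → ℤ
      gap i = U - + P * (+ m * + level i)
      base-gap = U - + P * (+ m * + base)
      atMin : Fin n → ℤ
      atMin i = base-gap * (𝟙 (a Fin.≟ i) + 𝟙 (b Fin.≟ i))
      atMin≤gap : ∀ i → atMin i ℤ.≤ gap i
      atMin≤gap i with a Fin.≟ i | b Fin.≟ i
      ... | yes a≡i  | yes b≡i  = contradiction (trans a≡i (sym b≡i)) a≢b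
      ... | yes refl | no _     = ≤-reflexive (trans (*-identityʳ base-gap)
            (cong (λ h → U - + P * (+ m * + h)) (sym level-a)))
      ... | no _     | yes refl = ≤-reflexive (trans (*-identityʳ base-gap)
            (cong (λ h → U - + P * (+ m * + h)) (sym level-b)))
      ... | no _     | no _     = ≤-trans (≤-reflexive (*-zeroʳ base-gap)) (i≤j⇒0≤j-i (level-upper i))
      slack : 0ℤ ℤ.≤ ∑ gap (allFin n) - ∑ atMin (allFin n)
      slack = i≤j⇒0≤j-i (∑-mono-∈ (allFin n) λ {i} _ → atMin≤gap i)
      doubled≡ : ∑ atMin (allFin n) ≡ base-gap * + 2
      doubled≡ = trans (∑-distribˡ-* base-gap (λ i → 𝟙 (a Fin.≟ i) + 𝟙 (b Fin.≟ i)) (allFin n))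
        (cong (base-gap *_) (trans (∑-distrib-+ (λ i → 𝟙 (a Fin.≟ i)) (λ i → 𝟙 (b Fin.≟ i)) (allFin n))
                                   (cong₂ _+_ (∑-≟ n a) (∑-≟ n b))))
      sum≡ : ∑ gap (allFin n) ≡ + n * U + - (+ P * + m) * (+ T + + base)
      sum≡ = trans (∑-cong (allFin n) λ i → regroup (+ P) (+ m) (+ level i) U)
        (trans (∑-distrib-+ (λ _ → U) (λ i → - (+ P * + m) * + level i) (allFin n))
        (cong₂ _+_
          (trans (∑-const U (allFin n)) (cong (λ l → + l * U) (List.length-tabulate (id {A = Fin n}))))
          (trans (∑-distribˡ-* (- (+ P * + m)) (λ i → + level i) (allFin n))
                 (cong (- (+ P * + m) *_) (trans total (cong (λ l → + l + + base) length≡))))))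
        where
        regroup : ∀ P m h U → U - P * (m * h) ≡ U + - (P * m) * h
        regroup = solve-∀
      lemma : ∀ k N P T M →
        (+ 2 + k) * (P * T + + 3 * N) + - (P * (1ℤ + k)) * (T + M)
        - (P * T + + 3 * N - P * ((1ℤ + k) * M)) * + 2 + + 6 * N
        ≡ P * ((1ℤ + k) * M) - (P * T - + 3 * (+ 2 + k) * N)
      lemma = solve-∀

    checkpoint-0 : checkpoint N P 0 ≡ 0
    checkpoint-0 = 0/n≡0 P

    -- Checkpoint 0 is the start, so regularity there concerns the whole sequence.
    occurrences-near : ∀ i →
      + P * (+ n * + occurrences i ω - + n * + N) ℤ.≤ + N ×
      + P * (+ n * + N - + n * + occurrences i ω) ℤ.≤ + N
    occurrences-near i =
      subst (λ z → + P * z ℤ.≤ + N) sum≡ (proj₁ at0) ,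
      subst (λ z → + P * z ℤ.≤ + N) (trans (cong -_ sum≡) (negate (+ n) (+ occurrences i ω) (+ N))) (proj₂ at0)
      where
      at0 = subst (λ r → + P * suffixSum (deviation i) r ω ℤ.≤ + N ×
                         + P * - suffixSum (deviation i) r ω ℤ.≤ + N)
                  checkpoint-0 (regular i 0 ℕ.z≤n)
      lemma : ∀ n o N → n * o - (N * n - 0ℤ) ≡ n * o - n * N
      lemma = solve-∀
      negate : ∀ n o N → - (n * o - n * N) ≡ n * N - n * o
      negate = solve-∀
      sum≡ : suffixSum (deviation i) 0 ω ≡ + n * + occurrences i ω - + n * + N
      sum≡ = trans (suffixSum-occurrences i 0 ℕ.z≤n)
        (trans (cong (λ t → + n * + occurrences i ω - (t - 0ℤ)) (pos-* N n))
               (lemma (+ n) (+ occurrences i ω) (+ N)))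

    level-near : ∀ i →
      + P * (+ m * + level i - + n * + N) ℤ.≤ + 3 * + n * + N ×
      + P * (+ n * + N - + m * + level i) ℤ.≤ + 3 * + n * + N
    level-near i =
      ≤-from-difference (0≤i+j (i≤j⇒0≤j-i (level-upper i)) (0≤i*j (0≤i*j (0≤+ 3) (0≤+ m)) (0≤+ N)))
        (trans (cong (λ t → + P * t + + 3 * + N - + P * (+ m * + level i) + + 3 * + m * + N) (pos-* N n))
               (upper (+ m) (+ N) (+ P) (+ level i))) ,
      ≤-from-difference (0≤i+j (i≤j⇒0≤j-i base-lower)
          (0≤i*j (0≤i*j (0≤+ P) (0≤+ m)) (i≤j⇒0≤j-i (+≤+ (base≤ i)))))
        (trans (cong (λ t → + P * (+ m * + base) - (+ P * t - + 3 * + n * + N)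
                             + + P * + m * (+ level i - + base)) (pos-* N n))
               (lower (+ m) (+ n) (+ N) (+ P) (+ level i) (+ base)))
      where
      upper : ∀ m N P h → P * (N * (1ℤ + m)) + + 3 * N - P * (m * h) + + 3 * m * N
              ≡ + 3 * (1ℤ + m) * N - P * (m * h - (1ℤ + m) * N)
      upper = solve-∀
      lower : ∀ m n N P h M → P * (m * M) - (P * (N * n) - + 3 * n * N) + P * m * (h - M)
              ≡ + 3 * n * N - P * (n * N - m * h)
      lower = solve-∀

    -- From `P * n * (N - o) ≤ N` and `P * n ≥ 2`. It makes `o` positive, hence the relative error
    -- finite, and converts errors measured in `N` into errors measured in `o`.
    half-occurrences : ∀ i → + N ℤ.≤ + 2 * + occurrences i ω
    half-occurrences i = *-cancelˡ-≤-pos _ _ (+ (P ℕ.* n)) {{P*n>0}} (≤-from-difference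
      (0≤i+j (0≤i*j (0≤+ 2) (i≤j⇒0≤j-i (proj₂ (occurrences-near i))))
             (0≤i*j (i≤j⇒0≤j-i (+≤+ 2≤P*n)) (0≤+ N)))
      (trans (cong (λ z → + 2 * (+ N - + P * (+ n * + N - + n * + o)) + (z - + 2) * + N) (pos-* P n))
      (trans (lemma (+ P) (+ n) (+ N) (+ o)) (cong (λ z → z * (+ 2 * + o) - z * + N) (sym (pos-* P n))))))
      where
      o = occurrences i ω
      2≤P*n : 2 ≤ P ℕ.* n
      2≤P*n = ℕ.*-mono-≤ (ℕ.>-nonZero⁻¹ P) (ℕ.s≤s (ℕ.s≤s ℕ.z≤n))
      P*n>0 : Positive (+ (P ℕ.* n))
      P*n>0 = positive (+<+ (ℕ.≤-trans (ℕ.s≤s ℕ.z≤n) 2≤P*n))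
      lemma : ∀ P n N o → + 2 * (N - P * (n * N - n * o)) + (P * n - + 2) * N
              ≡ P * n * (+ 2 * o) - P * n * N
      lemma = solve-∀

    -- The factor `8 * n` absorbs all constants. The most demanding case is the edge error, where
    -- `(3 * n + 1) * N ≤ 4 * n * N ≤ 8 * n * o`.
    module _ (K : ℕ) (P≡ : P ≡ 8 ℕ.* n ℕ.* K) where

      +P≡ : + P ≡ + 8 * + n * + K
      +P≡ = trans (cong +_ P≡) (trans (pos-* (8 ℕ.* n) K) (cong (_* + K) (pos-* 8 n)))

      refine : ∀ x y → + P * x ℤ.≤ + 8 * + n * y → + K * x ℤ.≤ y
      refine x y Px≤ = *-cancelˡ-≤-pos _ _ (+ 8 * + n) {{8n>0}}
        (≤-trans (≤-reflexive (trans (sym (*-assoc (+ 8 * + n) (+ K) x)) (cong (_* x) (sym +P≡)))) Px≤)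
        where
        8n>0 : Positive (+ 8 * + n)
        8n>0 = subst Positive (pos-* 8 n) _

      weaken : ∀ x → 0ℤ ℤ.≤ x → x ℤ.≤ x * + m
      weaken x 0≤x = ≤-from-difference (0≤i*j 0≤x (0≤+ k)) (lemma x (+ k))
        where
        lemma : ∀ x k → x * k ≡ x * (1ℤ + k) - x
        lemma = solve-∀

      -- The cross-multiplied form of a distance of at most `1 / K` between `level i / N` and
      -- `n / m`, as `∣difference∣≤` takes it.
      level-ratio : ∀ i →
        + K * (+ level i * + m - + n * + N) ℤ.≤ + N * + m ×
        + K * (+ n * + N - + level i * + m) ℤ.≤ + N * + m
      level-ratio i =
        bound _ (subst (λ z → + P * (z - + n * + N) ℤ.≤ + 3 * + n * + N)
                       (*-comm (+ m) (+ level i)) (proj₁ (level-near i))) ,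
        bound _ (subst (λ z → + P * (+ n * + N - z) ℤ.≤ + 3 * + n * + N)
                       (*-comm (+ m) (+ level i)) (proj₂ (level-near i)))
        where
        lemma : ∀ n N → + 5 * n * N ≡ + 8 * n * N - + 3 * n * N
        lemma = solve-∀
        bound : ∀ x → + P * x ℤ.≤ + 3 * + n * + N → + K * x ℤ.≤ + N * + m
        bound x le = ≤-trans (refine x (+ N) (≤-trans le (≤-from-difference
          (0≤i*j (0≤i*j (0≤+ 5) (0≤+ n)) (0≤+ N)) (lemma (+ n) (+ N))))) (weaken (+ N) (0≤+ N))

      vertex-ratio : ∀ v →
        + K * (+ c v * + m - + n * + N) ℤ.≤ + N * + m ×
        + K * (+ n * + N - + c v * + m) ℤ.≤ + N * + m
      vertex-ratio v with ℕ.⊔-sel (level (Process.end₁ n v)) (level (Process.end₂ n v))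
      ... | inj₁ eq rewrite trans (counter v) eq = level-ratio (Process.end₁ n v)
      ... | inj₂ eq rewrite trans (counter v) eq = level-ratio (Process.end₂ n v)

      -- The edge counter is a level `h`. Adding the estimates for `m * h - n * N` and
      -- `n * N - n * o` eliminates `N` and leaves `(h - o) * m - o`, because `n = m + 1`.
      edge-ratio : ∀ e → let o = occurrences e ω; h = CU.edgeCounter (Process.H n) c e in
        + K * ((+ h - + o) * + m - 1ℤ * + o) ℤ.≤ + o * + m ×
        + K * (1ℤ * + o - (+ h - + o) * + m) ℤ.≤ + o * + m
      edge-ratio e rewrite edgeCounter-level e =
        bound _ _ _ (proj₁ (level-near e)) (proj₂ (occurrences-near e)) (up (+ P) (+ m) (+ h) (+ N) (+ o)) ,
        bound _ _ _ (proj₂ (level-near e)) (proj₁ (occurrences-near e)) (down (+ P) (+ m) (+ h) (+ N) (+ o))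
        where
        h = level e
        o = occurrences e ω
        up : ∀ P m h N o → P * (m * h - (1ℤ + m) * N) + P * ((1ℤ + m) * N - (1ℤ + m) * o)
             ≡ P * ((h - o) * m - 1ℤ * o)
        up = solve-∀
        down : ∀ P m h N o → P * ((1ℤ + m) * N - m * h) + P * ((1ℤ + m) * o - (1ℤ + m) * N)
               ≡ P * (1ℤ * o - (h - o) * m)
        down = solve-∀
        lemma : ∀ m N o → + 4 * (1ℤ + m) * (+ 2 * o - N) + m * N
                ≡ + 8 * (1ℤ + m) * o - (+ 3 * (1ℤ + m) * N + N)
        lemma = solve-∀
        bound : ∀ x y z → x ℤ.≤ + 3 * + n * + N → y ℤ.≤ + N → x + y ≡ + P * z → + K * z ℤ.≤ + o * + m
        bound x y z x≤ y≤ eq = ≤-trans (refine z (+ o) (≤-trans (≤-reflexive (sym eq))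
          (≤-trans (+-mono-≤ x≤ y≤) (≤-from-difference
            (0≤i+j (0≤i*j (0≤i*j (0≤+ 4) (0≤+ n)) (i≤j⇒0≤j-i (half-occurrences e)))
                   (0≤i*j (0≤+ m) (0≤+ N)))
            (lemma (+ m) (+ N) (+ o)))))) (weaken (+ o) (0≤+ o))

-- Rational estimates and Chebyshev's inequality

toℚᵘ-/ : ∀ x d .{{_ : ℕ.NonZero d}} → toℚᵘ (x / d) ℚᵘ.≃ x ℚᵘ./ d
toℚᵘ-/ x (suc d) = ℚ.toℚᵘ-fromℚᵘ (ℚᵘ.mkℚᵘ x d)

difference≤ : ∀ x y b d K .{{_ : ℕ.NonZero b}} .{{_ : ℕ.NonZero d}} .{{_ : ℕ.NonZero K}} →
  + K * (x * + d - y * + b) ℤ.≤ + b * + d → x / b ℚ.- y / d ℚ.≤ + 1 / K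
difference≤ x y b@(suc _) d@(suc _) K@(suc _) le = ℚ.toℚᵘ-cancel-≤
  (ℚᵘ.≤-respˡ-≃ (ℚᵘ.≃-sym lhs) (ℚᵘ.≤-respʳ-≃ (ℚᵘ.≃-sym (toℚᵘ-/ (+ 1) K)) (ℚᵘ.*≤* le′)))
  where
  lhs : toℚᵘ (x / b ℚ.- y / d) ℚᵘ.≃ (x ℚᵘ./ b) ℚᵘ.- (y ℚᵘ./ d)
  lhs = ℚᵘ.≃-trans (ℚ.toℚᵘ-homo-+ (x / b) (ℚ.- (y / d)))
    (ℚᵘ.+-cong (toℚᵘ-/ x b) (ℚᵘ.≃-trans (ℚ.toℚᵘ-homo‿- (y / d)) (ℚᵘ.-‿cong (toℚᵘ-/ y d))))
  lemma : ∀ x y b d K → (x * d + - y * b) * K ≡ K * (x * d - y * b)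
  lemma = solve-∀
  le′ : (x * + d + - y * + b) * + K ℤ.≤ 1ℤ * + (b ℕ.* d)
  le′ = ≤-trans (≤-reflexive (lemma x y (+ b) (+ d) (+ K)))
    (≤-trans le (≤-reflexive (trans (sym (pos-* b d)) (sym (*-identityˡ _)))))

∣p∣≤ : ∀ p {q} → p ℚ.≤ q → ℚ.- p ℚ.≤ q → ℚ.∣ p ∣ ℚ.≤ q
∣p∣≤ p p≤q -p≤q with ℚ.∣p∣≡p∨∣p∣≡-p p
... | inj₁ eq = subst (ℚ._≤ _) (sym eq) p≤q
... | inj₂ eq = subst (ℚ._≤ _) (sym eq) -p≤q

∣difference∣≤ : ∀ x y b d K .{{_ : ℕ.NonZero b}} .{{_ : ℕ.NonZero d}} .{{_ : ℕ.NonZero K}} →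
  + K * (x * + d - y * + b) ℤ.≤ + b * + d → + K * (y * + b - x * + d) ℤ.≤ + b * + d →
  ℚ.∣ x / b ℚ.- y / d ∣ ℚ.≤ + 1 / K
∣difference∣≤ x y b d K upper lower = ∣p∣≤ _ (difference≤ x y b d K upper)
  (subst (ℚ._≤ + 1 / K) (sym (⁻¹-anti-homo‿- ℚ.+-0-abelianGroup (x / b) (y / d)))
    (difference≤ y x d b K (subst (+ K * (y * + b - x * + d) ℤ.≤_) (*-comm (+ b) (+ d)) lower)))

-- A positive rational is at least one over its denominator; adding one to the denominator makes the
-- inequality strict.
archimedean : ∀ ε → 0ℚ ℚ.< ε → ∃ λ K → + 1 / suc K ℚ.< ε
archimedean (mkℚ +[1+ a ] d-1 _) _ = suc d-1 , ℚ.toℚᵘ-cancel-<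
  (ℚᵘ.<-respˡ-≃ (ℚᵘ.≃-sym (toℚᵘ-/ (+ 1) (suc (suc d-1)))) (ℚᵘ.*<*
    (<-≤-trans (+<+ (ℕ.≤-reflexive (cong suc (ℕ.*-identityˡ (suc d-1)))))
      (≤-trans (+≤+ (ℕ.m≤n*m (suc (suc d-1)) (suc a))) (≤-reflexive (pos-* (suc a) _))))))
archimedean (mkℚ +0 _ _)       (ℚ.*<* (+<+ ()))
archimedean (mkℚ -[1+ _ ] _ _) (ℚ.*<* ())

Within-mono : ∀ {ε ε′ c} x → ε ℚ.≤ ε′ → Within ε c x → Within ε′ c x
Within-mono [ x ] ε≤ε′ within = ℚ.≤-trans within ε≤ε′

Pr-near-1 : ∀ {P : A → Set} (P? : Decidable P) xs K .{{_ : ℕ.NonZero K}} → ∃ (_∈ xs) →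
  + K * (+ length xs - + length (filter P? xs)) ℤ.≤ + length xs → ℚ.∣ Pr xs P? ℚ.- 1ℚ ∣ ℚ.≤ + 1 / K
Pr-near-1 P? []         K (_ , ()) le
Pr-near-1 P? xs@(_ ∷ _) K _        le = ∣difference∣≤ (+ g) 1ℤ (length xs) 1 K
  (≤-trans (*-monoˡ-≤-nonNeg (+ K) (≤-trans (≤-reflexive (upper (+ g) (+ L)))
                                            (i≤j⇒i-j≤0 (+≤+ (List.length-filter P? xs)))))
    (≤-trans (≤-reflexive (*-zeroʳ (+ K))) (0≤i*j (0≤+ L) (0≤+ 1))))
  (≤-trans (≤-reflexive (cong (+ K *_) (lower (+ g) (+ L))))
           (≤-trans le (≤-reflexive (sym (*-identityʳ (+ L))))))
  where
  g = length (filter P? xs)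
  L = length xs
  upper : ∀ g L → g * + 1 - 1ℤ * L ≡ g - L
  upper = solve-∀
  lower : ∀ g L → 1ℤ * L - g * + 1 ≡ L - g
  lower = solve-∀

-- Markov's inequality in counting form: an outcome outside `P` has `Z` above `t`, and any other
-- contributes 0 on the left.
markov : ∀ {P : A → Set} (P? : Decidable P) (Z : A → ℤ) t xs →
  (∀ x → 0ℤ ℤ.≤ Z x) → (∀ {x} → x ∈ xs → Z x ℤ.≤ t → P x) →
  t * (+ length xs - + length (filter P? xs)) ℤ.≤ ∑ Z xs
markov P? Z t xs 0≤Z implies = ≤-trans (≤-reflexive eq) (∑-mono-∈ xs bound)
  where
  bad : _ → ℤ
  bad x = 1ℤ + - 1ℤ * 𝟙 (P? x)
  eq : t * (+ length xs - + length (filter P? xs)) ≡ ∑ (λ x → t * bad x) xs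
  eq = sym (trans (∑-distribˡ-* t bad xs) (cong (t *_)
    (trans (∑-distrib-+ (λ _ → 1ℤ) (λ x → - 1ℤ * 𝟙 (P? x)) xs)
      (cong₂ _+_ (sym (length-as-∑ xs)) (trans (∑-distribˡ-* (- 1ℤ) (λ x → 𝟙 (P? x)) xs)
        (trans (-1*i≡-i _) (cong -_ (sym (length-filter-as-∑ P? xs)))))))))
  bound : ∀ {x} → x ∈ xs → t * bad x ℤ.≤ Z x
  bound {x} x∈ with P? x
  ... | yes _ = ≤-trans (≤-reflexive (*-zeroʳ t)) (0≤Z x)
  ... | no ¬p = ≤-trans (≤-reflexive (*-identityʳ t)) (<⇒≤ (≰⇒> (¬p ∘ implies x∈)))

-- What Chebyshev's inequality needs at a fixed accuracy `1 / K`: a non-negative `Z` with mean of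
-- order `N` that forces closeness whenever it is at most the square of `N`.
record Controlled (Ω : ℕ → List A) (X : (N : ℕ) → .{{ℕ.NonZero N}} → A → ℚ ⁺) (c : ℚ)
                  (K : ℕ) .{{_ : ℕ.NonZero K}} : Set where
  field
    N₁ C     : ℕ
    Z        : ℕ → A → ℤ
    0≤Z      : ∀ N ω → 0ℤ ℤ.≤ Z N ω
    mean-Z   : ∀ N → .{{_ : ℕ.NonZero N}} → ∑ (Z N) (Ω N) ℤ.≤ + C * + N * + length (Ω N)
    within   : ∀ N → .{{_ : ℕ.NonZero N}} → N₁ ≤ N → ∀ {ω} → ω ∈ Ω N → Z N ω ℤ.≤ + N * + N →
               Within (+ 1 / K) c (X N ω)

controlled⇒WHP : ∀ (Ω : ℕ → List A) X c → (∀ N → ∃ (_∈ Ω N)) →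
  (∀ K → Controlled Ω X c (suc K)) → WHP Ω X c
controlled⇒WHP Ω X c inhabited controlled ε 0<ε δ 0<δ
  with K , 1/K<ε ← archimedean ε 0<ε | J , 1/J<δ ← archimedean δ 0<δ =
  -- Markov's inequality leaves a bad fraction of at most `C / N`, hence at most `1 / suc J` from
  -- here on. Taking `suc C` keeps the factor to be cancelled positive.
  N₁ ℕ.⊔ (suc J ℕ.* suc C) , λ N N₀≤N →
    ℚ.≤-<-trans (Pr-near-1 _ (Ω N) (suc J) (inhabited N) (bound N N₀≤N)) 1/J<δ
  where
  open Controlled (controlled K)
  bound : ∀ N → .{{_ : ℕ.NonZero N}} → N₁ ℕ.⊔ (suc J ℕ.* suc C) ≤ N →
    + suc J * (+ length (Ω N) - + length (filter (λ ω → within? ε c (X N ω)) (Ω N))) ℤ.≤ + length (Ω N)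
  bound N N₀≤N = *-cancelˡ-≤-pos _ _ (+ suc C) (begin
    + suc C * (+ suc J * bad)       ≡⟨ trans (lemma (+ suc C) (+ suc J) bad)
                                             (cong (_* bad) (sym (pos-* (suc J) (suc C)))) ⟩
    + (suc J ℕ.* suc C) * bad       ≤⟨ *-monoʳ-≤-nonNeg bad {{nonNegative 0≤bad}}
                                             (+≤+ (ℕ.≤-trans (ℕ.m≤n⊔m N₁ _) N₀≤N)) ⟩
    + N * bad                       ≤⟨ *-cancelˡ-≤-pos _ _ (+ N) {{N>0}} scaled ⟩
    + C * + L                       ≤⟨ *-monoʳ-≤-nonNeg (+ L) (+≤+ (ℕ.n≤1+n C)) ⟩
    + suc C * + L                   ∎)
    where
    open ≤-Reasoning
    L = length (Ω N)
    P? = λ ω → within? ε c (X N ω)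
    bad = + L - + length (filter P? (Ω N))
    0≤bad : 0ℤ ℤ.≤ bad
    0≤bad = i≤j⇒0≤j-i (+≤+ (List.length-filter P? (Ω N)))
    N>0 : Positive (+ N)
    N>0 = positive (+<+ (ℕ.>-nonZero⁻¹ N))
    lemma : ∀ a b x → a * (b * x) ≡ b * a * x
    lemma = solve-∀
    regroup : ∀ C N L → C * N * L ≡ N * (C * L)
    regroup = solve-∀
    scaled : + N * (+ N * bad) ℤ.≤ + N * (+ C * + L)
    scaled = begin
      + N * (+ N * bad)   ≡⟨ *-assoc (+ N) (+ N) bad ⟨
      + N * + N * bad     ≤⟨ markov P? (Z N) (+ N * + N) (Ω N) (0≤Z N) (λ {ω} ω∈ Z≤ →
                               Within-mono (X N ω) (ℚ.<⇒≤ 1/K<ε)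
                                 (within N (ℕ.≤-trans (ℕ.m≤m⊔n N₁ _) N₀≤N) ω∈ Z≤)) ⟩
      ∑ (Z N) (Ω N)       ≤⟨ mean-Z N ⟩
      + C * + N * + L     ≡⟨ regroup (+ C) (+ N) (+ L) ⟩
      + N * (+ C * + L)   ∎

-- Convergence in both models

checkpointSquare : ∀ {n} N P .{{_ : ℕ.NonZero P}} → List (Fin n) → Fin n → ℕ → ℤ
checkpointSquare N P ω i j =
  suffixSum (deviation i) (checkpoint N P j) ω * suffixSum (deviation i) (checkpoint N P j) ω

0≤checkpointSquare : ∀ {n} N P .{{_ : ℕ.NonZero P}} ω (i : Fin n) j → 0ℤ ℤ.≤ checkpointSquare N P ω i j
0≤checkpointSquare N P ω i j = 0≤i*i (suffixSum (deviation i) (checkpoint N P j) ω)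

-- A sum takes the place of a maximum over indices and checkpoints: it dominates every single
-- square, and its mean is bounded term by term.
discrepancy : ∀ n N P .{{_ : ℕ.NonZero P}} → List (Fin n) → ℤ
discrepancy n N P ω = ∑ (λ i → ∑ (checkpointSquare N P ω i) (upTo (suc (P ℕ.* n)))) (allFin n)

0≤discrepancy : ∀ n N P .{{_ : ℕ.NonZero P}} ω → 0ℤ ℤ.≤ discrepancy n N P ω
0≤discrepancy n N P ω =
  ∑-nonneg (allFin n) λ i → ∑-nonneg (upTo (suc (P ℕ.* n))) (0≤checkpointSquare N P ω i)

checkpointSquare≤discrepancy : ∀ n N P .{{_ : ℕ.NonZero P}} ω i j → j ≤ P ℕ.* n →
  checkpointSquare N P ω i j ℤ.≤ discrepancy n N P ω
checkpointSquare≤discrepancy n N P ω i j j≤ = ≤-trans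
  (term≤∑ js (0≤checkpointSquare N P ω i) (∈-upTo⁺ (ℕ.s≤s j≤)))
  (term≤∑ (allFin n) (λ i → ∑-nonneg js (0≤checkpointSquare N P ω i)) (∈-allFin i))
  where js = upTo (suc (P ℕ.* n))

mean-discrepancy : ∀ M n N P .{{_ : ℕ.NonZero P}} → 2 ≤ N ℕ.* n →
  ∑ (discrepancy n N P) (outcomes M n N) ℤ.≤
  + n * (+ suc (P ℕ.* n) * (+ (N ℕ.* n) * (+ length (outcomes M n N) * (+ n * + n))))
mean-discrepancy M n N P 2≤T = begin
  ∑ (discrepancy n N P) Ω
    ≡⟨ ∑-comm (λ ω i → ∑ (checkpointSquare N P ω i) js) Ω (allFin n) ⟩
  ∑ (λ i → ∑ (λ ω → ∑ (checkpointSquare N P ω i) js) Ω) (allFin n)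
    ≡⟨ ∑-cong (allFin n) (λ i → ∑-comm (λ ω → checkpointSquare N P ω i) Ω js) ⟩
  ∑ (λ i → ∑ (λ j → ∑ (λ ω → checkpointSquare N P ω i j) Ω) js) (allFin n)
    ≤⟨ ∑-mono-∈ (allFin n) (λ {i} _ → ≤-trans
         (∑-mono-∈ js λ {j} j∈ →
            outcomes-second-moment M i 2≤T (checkpoint N P j)
              (checkpoint-≤ N P n j (ℕ.s≤s⁻¹ (∈-upTo⁻ j∈))))
         (≤-reflexive (trans (∑-const bound js) (cong (λ l → + l * bound) (List.length-upTo (suc (P ℕ.* n))))))) ⟩
  ∑ (λ i → + suc (P ℕ.* n) * bound) (allFin n)
    ≡⟨ trans (∑-const (+ suc (P ℕ.* n) * bound) (allFin n))
             (cong (λ l → + l * (+ suc (P ℕ.* n) * bound)) (List.length-tabulate (id {A = Fin n}))) ⟩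
  + n * (+ suc (P ℕ.* n) * bound) ∎
  where
  open ≤-Reasoning
  Ω = outcomes M n N
  js = upTo (suc (P ℕ.* n))
  bound = + (N ℕ.* n) * (+ length Ω * (+ n * + n))

module Concentration (k J : ℕ) .{{_ : ℕ.NonZero J}} where

  n P : ℕ
  n = suc (suc k)
  P = 8 ℕ.* n ℕ.* J

  instance
    P≢0 : ℕ.NonZero P
    P≢0 = ℕ.m*n≢0 (8 ℕ.* n) J

  -- The factor `P * P` turns the threshold `N * N` for `Z` into the bound `N` on `P` times each
  -- suffix deviation, in either sign.
  Z : ℕ → List (Fin n) → ℤ
  Z N ω = + P * + P * discrepancy n N P ω

  C : ℕ
  C = P ℕ.* P ℕ.* (n ℕ.* (suc (P ℕ.* n) ℕ.* (n ℕ.* (n ℕ.* n))))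

  0≤Z : ∀ N ω → 0ℤ ℤ.≤ Z N ω
  0≤Z N ω = 0≤i*j (0≤i*i (+ P)) (0≤discrepancy n N P ω)

  mean-Z : ∀ M N → .{{_ : ℕ.NonZero N}} → ∑ (Z N) (outcomes M n N) ℤ.≤
           + C * + N * + length (outcomes M n N)
  mean-Z M N = begin
    ∑ (Z N) Ω
      ≡⟨ ∑-distribˡ-* (+ P * + P) (discrepancy n N P) Ω ⟩
    + P * + P * ∑ (discrepancy n N P) Ω
      ≤⟨ *-monoˡ-≤-nonNeg (+ P * + P) {{nonNegative (0≤i*i (+ P))}} (mean-discrepancy M n N P 2≤T) ⟩
    + P * + P * (+ n * (+ q * (+ (N ℕ.* n) * (+ L * (+ n * + n)))))
      ≡⟨ cong (λ t → + P * + P * (+ n * (+ q * (t * (+ L * (+ n * + n)))))) (pos-* N n) ⟩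
    + P * + P * (+ n * (+ q * (+ N * + n * (+ L * (+ n * + n)))))
      ≡⟨ lemma (+ P) (+ n) (+ q) (+ N) (+ L) ⟩
    + P * + P * (+ n * (+ q * (+ n * (+ n * + n)))) * + N * + L
      ≡⟨ cong (λ c → c * + N * + L) (sym C≡) ⟩
    + C * + N * + L ∎
    where
    open ≤-Reasoning
    Ω = outcomes M n N
    L = length Ω
    q = suc (P ℕ.* n)
    2≤T : 2 ≤ N ℕ.* n
    2≤T = ℕ.*-mono-≤ (ℕ.>-nonZero⁻¹ N) (ℕ.s≤s (ℕ.s≤s ℕ.z≤n))
    lemma : ∀ P n q N L → P * P * (n * (q * (N * n * (L * (n * n)))))
            ≡ P * P * (n * (q * (n * (n * n)))) * N * L
    lemma = solve-∀
    C≡ : + C ≡ + P * + P * (+ n * (+ q * (+ n * (+ n * + n))))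
    C≡ = trans (pos-* (P ℕ.* P) (n ℕ.* (suc (P ℕ.* n) ℕ.* (n ℕ.* (n ℕ.* n))))) (cong₂ _*_ (pos-* P P)
      (trans (pos-* n (q ℕ.* (n ℕ.* (n ℕ.* n)))) (cong (+ n *_) (trans (pos-* q (n ℕ.* (n ℕ.* n))) (cong (+ q *_)
        (trans (pos-* n (n ℕ.* n)) (cong (+ n *_) (pos-* n n))))))))

  regular : ∀ N .{{_ : ℕ.NonZero N}} (P≤N : P ≤ N) {ω} → Z N ω ℤ.≤ + N * + N →
            Deterministic.Regular k N P P≤N ω
  regular N P≤N {ω} Z≤ i j j≤ = scale D ≤-refl , scale (- D) (≤-reflexive (lemma D))
    where
    D = suffixSum (deviation i) (checkpoint N P j) ω
    lemma : ∀ x → - x * - x ≡ x * x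
    lemma = solve-∀
    square : ∀ p x → p * x * (p * x) ≡ p * p * (x * x)
    square = solve-∀
    scale : ∀ x → x * x ℤ.≤ D * D → + P * x ℤ.≤ + N
    scale x xx≤ = i*i≤j*j⇒i≤j (0≤+ N) (≤-trans (≤-reflexive (square (+ P) x))
      (≤-trans (*-monoˡ-≤-nonNeg (+ P * + P) {{nonNegative (0≤i*i (+ P))}}
        (≤-trans xx≤ (checkpointSquare≤discrepancy n N P ω i j j≤))) Z≤))

  H = dual (K n)

  controlled-vertex : ∀ M v → Controlled (outcomes M n) (λ N → vertexRatio H v N) (+ n / suc k) J
  controlled-vertex M v = record
    -- The rounding of checkpoints is controlled only once `P ≤ N`.
    { N₁     = P
    ; C      = C
    ; Z      = Z
    ; 0≤Z    = 0≤Z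
    ; mean-Z = mean-Z M
    ; within = λ N P≤N {ω} ω∈ Z≤ →
        let upper , lower = Deterministic.vertex-ratio k N P P≤N (profile k ω)
              (Exchangeable.length-∈ (outcomes-exchangeable M n N) ω∈) (regular N P≤N Z≤) J refl v
        in ∣difference∣≤ (+ CU.counters H ω v) (+ n) N (suc k) J upper lower
    }

  relErr-near : ∀ c o → 0 ℕ.< o →
    + J * ((+ c - + o) * + suc k - 1ℤ * + o) ℤ.≤ + o * + suc k →
    + J * (1ℤ * + o - (+ c - + o) * + suc k) ℤ.≤ + o * + suc k →
    Within (+ 1 / J) (+ 1 / suc k) (relErr c o)
  relErr-near c o@(suc _) _ upper lower = ∣difference∣≤ (+ c - + o) 1ℤ o (suc k) J upper lower

  controlled-edge : ∀ M e → Controlled (outcomes M n) (λ N → edgeError H e) (+ 1 / suc k) J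
  controlled-edge M e = record
    { N₁     = P
    ; C      = C
    ; Z      = Z
    ; 0≤Z    = 0≤Z
    ; mean-Z = mean-Z M
    ; within = λ N P≤N {ω} ω∈ Z≤ →
        let length≡ = Exchangeable.length-∈ (outcomes-exchangeable M n N) ω∈
            reg     = regular N P≤N Z≤
            upper , lower = Deterministic.edge-ratio k N P P≤N (profile k ω) length≡ reg J refl e
        in relErr-near (CU.edgeCounter H (CU.counters H ω) e) (occurrences e ω)
             (drawn N ω (Deterministic.half-occurrences k N P P≤N (profile k ω) length≡ reg e))
             upper lower
    }
    where
    drawn : ∀ N .{{_ : ℕ.NonZero N}} ω → + N ℤ.≤ + 2 * + occurrences e ω → 0 ℕ.< occurrences e ω
    drawn N ω N≤ = ℕ.*-cancelˡ-< 2 0 (occurrences e ω) (ℕ.<-≤-trans (ℕ.>-nonZero⁻¹ N)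
      (drop‿+≤+ (≤-trans N≤ (≤-reflexive (sym (pos-* 2 (occurrences e ω)))))))

theorem4 : (n : ℕ) (2≤n : 2 ≤ n) →
    let H = dual (K n)
        instance n-1≢0 = >-nonZero (m<n⇒0<n∸m 2≤n)
    in (M : Model) →
       ((v : Fin (#V H)) → WHP (outcomes M (#E H)) (λ N → vertexRatio H v N) (+ n / (n ∸ 1)))
     × ((e : Fin (#E H)) → WHP (outcomes M (#E H)) (λ N → edgeError H e) (+ 1 / (n ∸ 1)))
theorem4 n@(suc (suc k)) (ℕ.s≤s (ℕ.s≤s _)) M =
  (λ v → controlled⇒WHP (outcomes M n) (λ N → vertexRatio (dual (K n)) v N) _ inhabited
           λ K-1 → Concentration.controlled-vertex k (suc K-1) M v) ,
  (λ e → controlled⇒WHP (outcomes M n) (λ N → edgeError (dual (K n)) e) _ inhabited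
           λ K-1 → Concentration.controlled-edge k (suc K-1) M e)
  where
  inhabited : ∀ N → ∃ (_∈ outcomes M n N)
  inhabited N = blocks n N , blocks∈outcomes M n N
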